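{- Every finitely generated field has a d-$\Sigma^0_2$ Scott sentence.
   Context: $\mathcal{L}_{\omega_1\omega}$ is the infinitary logic allowing countable conjunctions and disjunctions but only finite quantification. A formula is $\Sigma^0_0$ and $\Pi^0_0$ if it is finitary and quantifier-free; it is $\Sigma^0_\alpha$ if it is a countable disjunction of formulas $\exists \bar{x}\,\phi$ with each $\phi$ being $\Pi^0_\beta$ for some $\beta<\alpha$; it is $\Pi^0_\alpha$ if it is a countable conjunction of formulas $\forall \bar{x}\,\phi$ with each $\phi$ being $\Sigma^0_\beta$ for some $\beta<\alpha$; d-$\Sigma^0_\alpha$ means a conjunction of a $\Sigma^0_\alpha$ and a $\Pi^0_\alpha$ formula. A Scott sentence for a countable structure $\mathcal{A}$ is an $\mathcal{L}_{\omega_1\omega}$ sentence whose countable models are exactly the isomorphic copies of $\mathcal{A}$. A field is finitely generated if it is generated as a field (over its prime field) by finitely many elements. -}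

module Defs where

open import Level using (0ℓ)
open import Data.Nat using (ℕ; zero; suc; _+_; _<_)
open import Data.Fin using (Fin)
open import Data.Vec using (Vec; lookup; _++_; [])
open import Data.Product using (Σ; ∃; _×_; _,_)
open import Data.Empty using (⊥)
open import Data.Unit using (⊤)
open import Data.Sum using (_⊎_)
open import Relation.Nullary using (¬_)
open import Relation.Binary.PropositionalEquality using (_≡_; _≢_)
open import Algebra.Structures using (IsCommutativeRing)

-- Structures for the language of rings {+, ·, -, 0, 1}.
-- Equality symbol is interpreted as true (propositional) equality.

record Str : Set₁ where
  field
    Carrier : Set
    _⊕_ : Carrier → Carrier → Carrier
    _⊗_ : Carrier → Carrier → Carrier
    ⊖_  : Carrier → Carrier
    𝟘   : Carrier
    𝟙   : Carrier

open Str public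

-- A structure is countable: its universe is the image of ℕ (structures in
-- this language are nonempty, as they interpret constants).
Countable : Str → Set
Countable M = Σ (ℕ → Carrier M) λ e → ∀ (x : Carrier M) → ∃ λ n → e n ≡ x

record _≅_ (M N : Str) : Set where
  field
    to      : Carrier M → Carrier N
    from    : Carrier N → Carrier M
    from-to : ∀ x → from (to x) ≡ x
    to-from : ∀ y → to (from y) ≡ y
    pres-⊕  : ∀ x y → to (_⊕_ M x y) ≡ _⊕_ N (to x) (to y)
    pres-⊗  : ∀ x y → to (_⊗_ M x y) ≡ _⊗_ N (to x) (to y)
    pres-⊖  : ∀ x → to (⊖_ M x) ≡ ⊖_ N (to x)
    pres-𝟘  : to (𝟘 M) ≡ 𝟘 N
    pres-𝟙  : to (𝟙 M) ≡ 𝟙 N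

record IsFieldStr (M : Str) : Set where
  field
    isCommutativeRing : IsCommutativeRing _≡_ (_⊕_ M) (_⊗_ M) (⊖_ M) (𝟘 M) (𝟙 M)
    0≢1     : 𝟘 M ≢ 𝟙 M
    inverse : ∀ x → x ≢ 𝟘 M → ∃ λ y → _⊗_ M x y ≡ 𝟙 M

data Gen (M : Str) {k : ℕ} (a : Vec (Carrier M) k) : Carrier M → Set where
  gen  : ∀ i → Gen M a (lookup a i)
  g𝟘   : Gen M a (𝟘 M)
  g𝟙   : Gen M a (𝟙 M)
  g⊕   : ∀ {x y} → Gen M a x → Gen M a y → Gen M a (_⊕_ M x y)
  g⊗   : ∀ {x y} → Gen M a x → Gen M a y → Gen M a (_⊗_ M x y)
  g⊖   : ∀ {x} → Gen M a x → Gen M a (⊖_ M x)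
  ginv : ∀ {x y} → Gen M a x → x ≢ 𝟘 M → _⊗_ M x y ≡ 𝟙 M → Gen M a y

FinitelyGenerated : Str → Set
FinitelyGenerated M =
  Σ ℕ λ k → Σ (Vec (Carrier M) k) λ a → ∀ (x : Carrier M) → Gen M a x

data Term (m : ℕ) : Set where
  var  : Fin m → Term m
  _∔_  : Term m → Term m → Term m
  _∙_  : Term m → Term m → Term m
  neg  : Term m → Term m
  zer  : Term m
  one  : Term m

data QF (m : ℕ) : Set where
  _≐_  : Term m → Term m → QF m
  tt   : QF m
  ff   : QF m
  ¬'_  : QF m → QF m
  _∧'_ : QF m → QF m → QF m
  _∨'_ : QF m → QF m → QF m

-- Infinitary formulas of L_{ω₁ω} in normal form by complexity level
-- (finite levels α suffice here).  Σf α m / Πf α m : Σ⁰_α / Π⁰_α formulas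
-- with m free variables.  Countable disjunctions/conjunctions are indexed
-- by ℕ; the i-th disjunct (conjunct) is ∃ x̄ φ (∀ x̄ φ) where x̄ is a block
-- of k i variables and φ is Π⁰_β (Σ⁰_β) for some β = lvl i < α.
mutual
  data Σf : ℕ → ℕ → Set where
    qfΣ : ∀ {m} → QF m → Σf 0 m
    ⋁∃  : ∀ {α m} (k : ℕ → ℕ) (lvl : ℕ → ℕ) → (∀ i → lvl i < suc α) →
          ((i : ℕ) → Πf (lvl i) (k i + m)) → Σf (suc α) m

  data Πf : ℕ → ℕ → Set where
    qfΠ : ∀ {m} → QF m → Πf 0 m
    ⋀∀  : ∀ {α m} (k : ℕ → ℕ) (lvl : ℕ → ℕ) → (∀ i → lvl i < suc α) →
          ((i : ℕ) → Σf (lvl i) (k i + m)) → Πf (suc α) m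

dΣ : ℕ → Set
dΣ α = Σf α 0 × Πf α 0

module _ (M : Str) where
  evalT : ∀ {m} → Term m → Vec (Carrier M) m → Carrier M
  evalT (var x) ρ = lookup ρ x
  evalT (s ∔ t) ρ = _⊕_ M (evalT s ρ) (evalT t ρ)
  evalT (s ∙ t) ρ = _⊗_ M (evalT s ρ) (evalT t ρ)
  evalT (neg t) ρ = ⊖_ M (evalT t ρ)
  evalT zer     ρ = 𝟘 M
  evalT one     ρ = 𝟙 M

  satQF : ∀ {m} → QF m → Vec (Carrier M) m → Set
  satQF (s ≐ t)  ρ = evalT s ρ ≡ evalT t ρ
  satQF tt       ρ = ⊤
  satQF ff       ρ = ⊥
  satQF (¬' φ)   ρ = ¬ satQF φ ρ
  satQF (φ ∧' ψ) ρ = satQF φ ρ × satQF ψ ρ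
  satQF (φ ∨' ψ) ρ = satQF φ ρ ⊎ satQF ψ ρ

  mutual
    satΣ : ∀ {α m} → Σf α m → Vec (Carrier M) m → Set
    satΣ (qfΣ φ) ρ = satQF φ ρ
    satΣ (⋁∃ k lvl _ φ) ρ =
      ∃ λ (i : ℕ) → ∃ λ (xs : Vec (Carrier M) (k i)) → satΠ (φ i) (xs ++ ρ)

    satΠ : ∀ {α m} → Πf α m → Vec (Carrier M) m → Set
    satΠ (qfΠ φ) ρ = satQF φ ρ
    satΠ (⋀∀ k lvl _ φ) ρ =
      ∀ (i : ℕ) (xs : Vec (Carrier M) (k i)) → satΣ (φ i) (xs ++ ρ)

_⊨d_ : ∀ {α} → Str → dΣ α → Set
M ⊨d (φ , ψ) = satΣ M φ [] × satΠ M ψ []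

IsScottSentence : ∀ {α} → dΣ α → Str → Set₁
IsScottSentence θ A = ∀ (B : Str) → Countable B → (B ⊨d θ → A ≅ B) × (A ≅ B → B ⊨d θ)

{-# OPTIONS --safe #-}

-- Let a be a generating tuple of F. The sentence says: some tuple x̄ satisfies every true statement
-- "the polynomial t(x, a) has no root x" about a; the field axioms hold; and every tuple x̄ satisfying
-- all these statements generates the field. The first kind of statement already fixes the quantifier-free
-- type of x̄ (t(a) = 0 means that t(a) x − 1 has no root), so a model is isomorphic to F.
--
-- That F itself is a model means: if b in F satisfies these statements, then the embedding φ : F → F with
-- φ(a) = b is onto. First, F is algebraic over φ(F). Otherwise pick y transcendental over φ(F); then
-- y, φ(y), …, φᵏ(y) are algebraically independent over the fixed field of φ, while counting monomials shows
-- that any k + 1 elements of a field generated by k elements are dependent. Second, suppose P is a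
-- polynomial over F and y a root of its image φ(P). Then P has a root r in F, because "P has no root" would
-- transfer from a to b; either y = φ(r), or y is a root of the image of P / (x − r), of smaller degree.
module Submission where

open import Defs
open import Level using (0ℓ)
open import Algebra.Bundles using (CommutativeRing)
open import Algebra.Structures using (IsCommutativeRing)
open import Axiom.ExcludedMiddle using (ExcludedMiddle)
open import Data.Empty using (⊥-elim)
open import Data.Fin using (Fin; zero; suc; toℕ; fromℕ<; punchIn; combine; remQuot; _↑ˡ_; _↑ʳ_)
open import Data.Fin.Properties using (toℕ<n; toℕ-fromℕ<; fromℕ<-toℕ; remQuot-combine; combine-remQuot)
open import Data.Nat as ℕ using (ℕ; zero; suc; _≤_; _<_; z≤n; s≤s)
import Data.Nat.Properties as ℕₚ
open import Algebra.Properties.CommutativeSemigroup ℕₚ.*-commutativeSemigroup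
  using () renaming (interchange to ℕ-interchange)
open import Data.Product using (Σ; ∃; ∃₂; _×_; _,_; proj₁; proj₂)
open import Data.Sum using (_⊎_; inj₁; inj₂; [_,_])
open import Data.Vec as Vec using (Vec; []; _∷_; lookup)
open import Data.Vec.Functional using (insertAt)
open import Data.Vec.Functional.Properties using (insertAt-lookup; insertAt-punchIn)
open import Data.Vec.Properties using (lookup-map; lookup-++ˡ; map-++; map-∘; map-cong; map-id)
open import Data.Product.Function.NonDependent.Propositional using (_×-⇔_)
open import Data.Sum.Function.Propositional using (_⊎-⇔_)
open import Data.Unit using (tt)
open import Function using (_∘_; _⇔_; mk⇔; Equivalence)
open import Function.Related.TypeIsomorphisms using (¬-cong-⇔)
open import Relation.Nullary using (¬_; Dec; yes; no; contradiction)
open import Relation.Nullary.Decidable using (decidable-stable)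
open import Relation.Binary.PropositionalEquality using (_≡_; _≢_; refl; sym; trans; cong; cong₂; subst; setoid; module ≡-Reasoning)
open import Relation.Binary.PropositionalEquality.Algebra using (isMagma)

-- Homomorphisms, evaluation of terms and fractions

record Hom (A B : Str) : Set where
  field
    ⟦_⟧    : Carrier A → Carrier B
    ⊕-homo : ∀ x y → ⟦ _⊕_ A x y ⟧ ≡ _⊕_ B ⟦ x ⟧ ⟦ y ⟧
    ⊗-homo : ∀ x y → ⟦ _⊗_ A x y ⟧ ≡ _⊗_ B ⟦ x ⟧ ⟦ y ⟧
    ⊖-homo : ∀ x → ⟦ ⊖_ A x ⟧ ≡ ⊖_ B ⟦ x ⟧
    𝟘-homo : ⟦ 𝟘 A ⟧ ≡ 𝟘 B
    𝟙-homo : ⟦ 𝟙 A ⟧ ≡ 𝟙 B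

  evalT-homo : ∀ {m} {ρ : Vec (Carrier A) m} {σ} → (∀ i → ⟦ lookup ρ i ⟧ ≡ lookup σ i) →
               ∀ t → ⟦ evalT A t ρ ⟧ ≡ evalT B t σ
  evalT-homo ρ≗σ (var i) = ρ≗σ i
  evalT-homo ρ≗σ (s ∔ t) = trans (⊕-homo _ _) (cong₂ (_⊕_ B) (evalT-homo ρ≗σ s) (evalT-homo ρ≗σ t))
  evalT-homo ρ≗σ (s ∙ t) = trans (⊗-homo _ _) (cong₂ (_⊗_ B) (evalT-homo ρ≗σ s) (evalT-homo ρ≗σ t))
  evalT-homo ρ≗σ (neg t) = trans (⊖-homo _) (cong (⊖_ B) (evalT-homo ρ≗σ t))
  evalT-homo ρ≗σ zer     = 𝟘-homo
  evalT-homo ρ≗σ one     = 𝟙-homo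

id-hom : ∀ A → Hom A A
id-hom A = record
  { ⟦_⟧ = λ x → x ; ⊕-homo = λ _ _ → refl ; ⊗-homo = λ _ _ → refl ; ⊖-homo = λ _ → refl
  ; 𝟘-homo = refl ; 𝟙-homo = refl }

rename : ∀ {m n} → (Fin m → Fin n) → Term m → Term n
rename f (var i) = var (f i)
rename f (s ∔ t) = rename f s ∔ rename f t
rename f (s ∙ t) = rename f s ∙ rename f t
rename f (neg t) = neg (rename f t)
rename f zer     = zer
rename f one     = one

evalT-rename : ∀ M {m n} (f : Fin m → Fin n) {ρ σ} → (∀ i → lookup ρ (f i) ≡ lookup σ i) →
               ∀ t → evalT M (rename f t) ρ ≡ evalT M t σ
evalT-rename M f eq (var i) = eq i
evalT-rename M f eq (s ∔ t) = cong₂ (_⊕_ M) (evalT-rename M f eq s) (evalT-rename M f eq t)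
evalT-rename M f eq (s ∙ t) = cong₂ (_⊗_ M) (evalT-rename M f eq s) (evalT-rename M f eq t)
evalT-rename M f eq (neg t) = cong (⊖_ M) (evalT-rename M f eq t)
evalT-rename M f eq zer     = refl
evalT-rename M f eq one     = refl

weaken : ∀ {m} → Term m → Term (suc m)
weaken = rename suc

evalT-weaken : ∀ M {m} (t : Term m) x ρ → evalT M (weaken t) (x ∷ ρ) ≡ evalT M t ρ
evalT-weaken M t x ρ = evalT-rename M suc (λ _ → refl) t

-- A term in 1 + m variables is read as a polynomial in variable zero whose coefficients are
-- terms in the remaining ones.
RootFree : (M : Str) → ∀ {m} → Vec (Carrier M) m → Term (suc m) → Set
RootFree M v t = ∀ x → evalT M t (x ∷ v) ≢ 𝟘 M

-- Fractions are described by cross-multiplication: terms have no division, and in this form the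
-- condition is a quantifier-free formula.
record IsFrac (M : Str) {k} (a : Vec (Carrier M) k) (s t : Term k) (x : Carrier M) : Set where
  constructor _,_
  field
    denominator≢0 : evalT M t a ≢ 𝟘 M
    quotient      : _⊗_ M (evalT M t a) x ≡ evalT M s a

Frac : (M : Str) → ∀ {k} → Vec (Carrier M) k → Carrier M → Set
Frac M {k} a x = ∃₂ λ (s t : Term k) → IsFrac M a s t x

-- A growth estimate for counting monomials

^-distribʳ-* : ∀ k m n → (m ℕ.* n) ℕ.^ k ≡ m ℕ.^ k ℕ.* n ℕ.^ k
^-distribʳ-* zero    m n = refl
^-distribʳ-* (suc k) m n = trans (cong (m ℕ.* n ℕ.*_) (^-distribʳ-* k m n)) (ℕ-interchange m n (m ℕ.^ k) (n ℕ.^ k))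

-- The left side counts monomials in `k` variables with exponents at most `(k + 1) d D`, the right
-- side those in `k + 1` variables with exponents below `d`. With `c = 1 + (k + 1) D` the left side
-- is at most `c^k d^k`, so any `d` above `c^k` suffices.
growth : ∀ k D → let d = suc (suc (suc k ℕ.* D) ℕ.^ k) in suc (suc k ℕ.* (d ℕ.* D)) ℕ.^ k < d ℕ.^ suc k
growth k D = begin-strict
  suc (suc k ℕ.* (d ℕ.* D)) ℕ.^ k  ≤⟨ ℕₚ.^-monoˡ-≤ k bound ⟩
  (c ℕ.* d) ℕ.^ k                  ≡⟨ ^-distribʳ-* k c d ⟩
  c ℕ.^ k ℕ.* d ℕ.^ k              <⟨ ℕₚ.*-monoˡ-< (d ℕ.^ k) {{ℕₚ.m^n≢0 d k}} (ℕₚ.n<1+n (c ℕ.^ k)) ⟩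
  d ℕ.* d ℕ.^ k                    ∎
  where
  open ℕₚ.≤-Reasoning
  c = suc (suc k ℕ.* D)
  d = suc (c ℕ.^ k)
  bound : suc (suc k ℕ.* (d ℕ.* D)) ≤ c ℕ.* d
  bound = begin
    suc (suc k ℕ.* (d ℕ.* D))  ≡⟨ cong (λ x → suc (suc k ℕ.* x)) (ℕₚ.*-comm d D) ⟩
    suc (suc k ℕ.* (D ℕ.* d))  ≡⟨ cong suc (ℕₚ.*-assoc (suc k) D d) ⟨
    suc (suc k ℕ.* D ℕ.* d)    ≤⟨ ℕₚ.+-monoˡ-≤ _ (s≤s z≤n) ⟩
    d ℕ.+ suc k ℕ.* D ℕ.* d    ∎

-- Arithmetic in a field

module Field (em : ExcludedMiddle 0ℓ) (F : Str) (isField : IsFieldStr F) where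

  open IsFieldStr isField public

  commutativeRing : CommutativeRing 0ℓ 0ℓ
  commutativeRing = record { isCommutativeRing = isCommutativeRing }

  open CommutativeRing commutativeRing public using
    ( _+_; _*_; -_; 0#; 1#; semiring; commutativeSemiring; ring; +-identityˡ; +-identityʳ; *-identityˡ; *-identityʳ
    ; *-comm; *-assoc; distribˡ; distribʳ; zeroˡ; zeroʳ; -‿inverseˡ; -‿inverseʳ )
  open import Algebra.Properties.Ring ring public using (-‿distribʳ-*; -1*x≈-x; x∙y⁻¹≈ε⇒x≈y)
  open import Algebra.Properties.Semiring.Sum semiring public
  open import Algebra.Properties.Semiring.Exp semiring public using (_^_; ^-homo-*)
  open import Algebra.Solver.Ring.NaturalCoefficients.Default commutativeSemiring public
    using (solve; _:+_; _:*_; _:=_)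

  open ≡-Reasoning

  1≢0 : 1# ≢ 0#
  1≢0 = 0≢1 ∘ sym

  *-swap : ∀ x y z → x * (y * z) ≡ y * (x * z)
  *-swap = solve 3 (λ x y z → x :* (y :* z) := y :* (x :* z)) refl

  *-cancelˡ-≢0 : ∀ {c x y} → c ≢ 0# → c * x ≡ c * y → x ≡ y
  *-cancelˡ-≢0 {c} {x} {y} c≢0 eq with d , cd≡1 ← inverse c c≢0 = begin
    x           ≡⟨ undo x ⟨
    d * (c * x) ≡⟨ cong (d *_) eq ⟩
    d * (c * y) ≡⟨ undo y ⟩
    y           ∎
    where
    undo : ∀ z → d * (c * z) ≡ z
    undo z = begin
      d * (c * z) ≡⟨ solve 3 (λ c d z → d :* (c :* z) := (c :* d) :* z) refl c d z ⟩
      (c * d) * z ≡⟨ cong (_* z) cd≡1 ⟩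
      1# * z      ≡⟨ *-identityˡ z ⟩
      z           ∎

  zero-product : ∀ {x y} → x ≢ 0# → x * y ≡ 0# → y ≡ 0#
  zero-product {x} x≢0 xy≡0 = *-cancelˡ-≢0 x≢0 (trans xy≡0 (sym (zeroʳ x)))

  *-≢0 : ∀ {x y} → x ≢ 0# → y ≢ 0# → x * y ≢ 0#
  *-≢0 x≢0 y≢0 = y≢0 ∘ zero-product x≢0

  ^-≢0 : ∀ {x} n → x ≢ 0# → x ^ n ≢ 0#
  ^-≢0 zero    x≢0 = 1≢0
  ^-≢0 (suc n) x≢0 = *-≢0 x≢0 (^-≢0 n x≢0)

  -- Finite sums

  sum-zero : ∀ {n} {f : Fin n → Carrier F} → (∀ i → f i ≡ 0#) → sum f ≡ 0#
  sum-zero {n} f≗0 = trans (sum-cong-≗ f≗0) (sum-replicate-zero n)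

  sum-↑ : ∀ m {n} (f : Fin (m ℕ.+ n) → Carrier F) →
          sum f ≡ sum (λ i → f (i ↑ˡ n)) + sum (λ j → f (m ↑ʳ j))
  sum-↑ zero    f = sym (+-identityˡ _)
  sum-↑ (suc m) f = trans (cong (f zero +_) (sum-↑ m (f ∘ suc)))
                          (solve 3 (λ x y z → x :+ (y :+ z) := (x :+ y) :+ z) refl (f zero) _ _)

  sum-combine : ∀ m {n} (f : Fin (m ℕ.* n) → Carrier F) →
                sum f ≡ sum (λ (i : Fin m) → sum (λ (j : Fin n) → f (combine i j)))
  sum-combine zero        f = refl
  sum-combine (suc m) {n} f = trans (sum-↑ n f)
    (cong (sum (λ j → f (combine {suc m} zero j)) +_) (sum-combine m (λ j → f (n ↑ʳ j))))

  δ : ∀ {n} → Fin n → Fin n → Carrier F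
  δ zero    zero    = 1#
  δ zero    (suc _) = 0#
  δ (suc _) zero    = 0#
  δ (suc i) (suc j) = δ i j

  sum-δ : ∀ {n} (i : Fin n) (u : Fin n → Carrier F) → sum (λ j → δ i j * u j) ≡ u i
  sum-δ zero u = begin
    1# * u zero + sum (λ j → 0# * u (suc j)) ≡⟨ cong₂ _+_ (*-identityˡ _) (sum-zero (λ j → zeroˡ (u (suc j)))) ⟩
    u zero + 0#                              ≡⟨ +-identityʳ _ ⟩
    u zero                                   ∎
  sum-δ (suc i) u = trans (cong₂ _+_ (zeroˡ _) (sum-δ i (u ∘ suc))) (+-identityˡ _)

  -- Linear algebra over a subring

  record IsSubring (K : Carrier F → Set) : Set where
    field
      0∈ : K 0#
      1∈ : K 1#
      +∈ : ∀ {x y} → K x → K y → K (x + y)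
      *∈ : ∀ {x y} → K x → K y → K (x * y)
      -∈ : ∀ {x} → K x → K (- x)

    sum∈ : ∀ {n} {f : Fin n → Carrier F} → (∀ i → K (f i)) → K (sum f)
    sum∈ {zero}  f∈ = 0∈
    sum∈ {suc n} f∈ = +∈ (f∈ zero) (sum∈ (f∈ ∘ suc))

    δ∈ : ∀ {n} (i j : Fin n) → K (δ i j)
    δ∈ zero    zero    = 1∈
    δ∈ zero    (suc _) = 0∈
    δ∈ (suc _) zero    = 0∈
    δ∈ (suc i) (suc j) = δ∈ i j

    insertAt∈ : ∀ {n} {f : Fin n → Carrier F} {x} p → (∀ i → K (f i)) → K x → ∀ i → K (insertAt f p x i)
    insertAt∈ zero    f∈ x∈ zero    = x∈
    insertAt∈ zero    f∈ x∈ (suc i) = f∈ i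
    insertAt∈ {suc n} (suc p) f∈ x∈ zero    = f∈ zero
    insertAt∈ {suc n} (suc p) f∈ x∈ (suc i) = insertAt∈ p (f∈ ∘ suc) x∈ i

    -- Fraction-free elimination, so that no inverses of elements of K are needed.
    kernel : ∀ {m n} → n < m → (C : Fin m → Fin n → Carrier F) → (∀ j i → K (C j i)) →
             ∃ λ (l : Fin m → Carrier F) →
               (∀ j → K (l j)) × (∃ λ j → l j ≢ 0#) × (∀ i → sum (λ j → l j * C j i) ≡ 0#)
    kernel {suc m} {zero} _ C C∈ = (λ _ → 1#) , (λ _ → 1∈) , (zero , 1≢0) , λ ()
    kernel {suc m} {suc n} (s≤s n<m) C C∈ with em {∃ λ p → C p zero ≢ 0#}
    -- Column zero vanishes, so a relation for the remaining columns is enough.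
    ... | no none =
      let l , l∈ , l≢0 , rel = kernel (ℕₚ.m<n⇒m<1+n n<m) (λ j → C j ∘ suc) (λ j → C∈ j ∘ suc)
          column₀ = λ j → decidable-stable em (λ ne → none (j , ne))
      in l , l∈ , l≢0 , λ where
        zero    → sum-zero λ j → trans (cong (l j *_) (column₀ j)) (zeroʳ _)
        (suc i) → rel i
    ... | yes (p , c≢0) = l , l∈ , (punchIn p j₀ , l≢0) , λ where
        zero    → trans (column zero) (sum-zero λ j → trans (cong (l′ j *_) (D₀≡0 j)) (zeroʳ _))
        (suc i) → trans (column (suc i)) (rel i)
      where
      c = C p zero
      C′ : Fin m → Fin (suc n) → Carrier F
      C′ j = C (punchIn p j)
      -- Row `j` of `D` is the pivot times row `j` minus `C′ j zero` times the pivot row, which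
      -- clears column zero.
      D : Fin m → Fin (suc n) → Carrier F
      D j i = c * C′ j i + (- C′ j zero) * C p i
      D₀≡0 : ∀ j → D j zero ≡ 0#
      D₀≡0 j = begin
        c * C′ j zero + (- C′ j zero) * c ≡⟨ solve 3 (λ c x y → c :* x :+ y :* c := c :* (x :+ y)) refl c (C′ j zero) _ ⟩
        c * (C′ j zero + (- C′ j zero))   ≡⟨ cong (c *_) (-‿inverseʳ _) ⟩
        c * 0#                            ≡⟨ zeroʳ c ⟩
        0#                                ∎
      IH = kernel n<m (λ j → D j ∘ suc)
             (λ j i → +∈ (*∈ (C∈ _ _) (C∈ _ _)) (*∈ (-∈ (C∈ _ _)) (C∈ _ _)))
      l′ = proj₁ IH
      l′∈ = proj₁ (proj₂ IH)
      j₀ = proj₁ (proj₁ (proj₂ (proj₂ IH)))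
      rel = proj₂ (proj₂ (proj₂ IH))
      -- With this coefficient for the pivot row, and the others multiplied by `c`, a relation among
      -- the rows of `D` becomes one among the rows of `C`. It stays nontrivial because `c` is
      -- nonzero.
      lₚ = sum (λ j → l′ j * (- C′ j zero))
      l = insertAt (λ j → c * l′ j) p lₚ
      l∈ : ∀ j → K (l j)
      l∈ = insertAt∈ p (λ j → *∈ (C∈ _ _) (l′∈ j)) (sum∈ (λ j → *∈ (l′∈ j) (-∈ (C∈ _ _))))
      l≢0 : l (punchIn p j₀) ≢ 0#
      l≢0 rewrite insertAt-punchIn (λ j → c * l′ j) p lₚ j₀ = *-≢0 c≢0 (proj₂ (proj₁ (proj₂ (proj₂ IH))))
      column : ∀ i → sum (λ j → l j * C j i) ≡ sum (λ j → l′ j * D j i)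
      column i = begin
        sum (λ j → l j * C j i)
          ≡⟨ sum-remove {i = p} (λ j → l j * C j i) ⟩
        l p * C p i + sum (λ j → l (punchIn p j) * C′ j i)
          ≡⟨ cong₂ _+_ (cong (_* C p i) (insertAt-lookup _ p lₚ))
               (sum-cong-≗ λ j → cong (_* C′ j i) (insertAt-punchIn _ p lₚ j)) ⟩
        lₚ * C p i + sum (λ j → c * l′ j * C′ j i)
          ≡⟨ cong (_+ sum (λ j → c * l′ j * C′ j i)) (*-distribʳ-sum (C p i) (λ j → l′ j * (- C′ j zero))) ⟩
        sum (λ j → l′ j * (- C′ j zero) * C p i) + sum (λ j → c * l′ j * C′ j i)
          ≡⟨ ∑-distrib-+ (λ j → l′ j * (- C′ j zero) * C p i) (λ j → c * l′ j * C′ j i) ⟨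
        sum (λ j → l′ j * (- C′ j zero) * C p i + c * l′ j * C′ j i)
          ≡⟨ sum-cong-≗ (λ j → solve 5 (λ l x y c z → l :* x :* y :+ c :* l :* z := l :* (c :* z :+ x :* y)) refl
               (l′ j) (- C′ j zero) (C p i) c (C′ j i)) ⟩
        sum (λ j → l′ j * D j i) ∎

  -- Fractions and polynomials

  module _ {k} {a : Vec (Carrier F) k} where

    IsFrac-unique : ∀ {s t x y} → IsFrac F a s t x → IsFrac F a s t y → x ≡ y
    IsFrac-unique (t≢0 , tx≡s) (_ , ty≡s) = *-cancelˡ-≢0 t≢0 (trans tx≡s (sym ty≡s))

    IsFrac-exists : ∀ s t → evalT F t a ≢ 0# → ∃ (IsFrac F a s t)
    IsFrac-exists s t t≢0 with t⁻¹ , tt⁻¹≡1 ← inverse _ t≢0 = t⁻¹ * evalT F s a , (t≢0 ,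
      trans (sym (*-assoc _ t⁻¹ _)) (trans (cong (_* evalT F s a) tt⁻¹≡1) (*-identityˡ _)))

    IsFrac-term : ∀ t → IsFrac F a t one (evalT F t a)
    IsFrac-term t = 1≢0 , *-identityˡ _

    IsFrac-+ : ∀ {s t s′ t′ x y} → IsFrac F a s t x → IsFrac F a s′ t′ y →
               IsFrac F a ((t′ ∙ s) ∔ (t ∙ s′)) (t ∙ t′) (x + y)
    IsFrac-+ {x = x} {y} (t≢0 , tx≡s) (t′≢0 , t′y≡s′) = *-≢0 t≢0 t′≢0 ,
      trans (solve 4 (λ t t′ x y → t :* t′ :* (x :+ y) := t′ :* (t :* x) :+ t :* (t′ :* y)) refl _ _ x y)
            (cong₂ (λ p q → _ * p + _ * q) tx≡s t′y≡s′)

    IsFrac-* : ∀ {s t s′ t′ x y} → IsFrac F a s t x → IsFrac F a s′ t′ y → IsFrac F a (s ∙ s′) (t ∙ t′) (x * y)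
    IsFrac-* {x = x} {y} (t≢0 , tx≡s) (t′≢0 , t′y≡s′) = *-≢0 t≢0 t′≢0 ,
      trans (solve 4 (λ t t′ x y → t :* t′ :* (x :* y) := (t :* x) :* (t′ :* y)) refl _ _ x y)
            (cong₂ _*_ tx≡s t′y≡s′)

    IsFrac-neg : ∀ {s t x} → IsFrac F a s t x → IsFrac F a (neg s) t (- x)
    IsFrac-neg {x = x} (t≢0 , tx≡s) = t≢0 , trans (sym (-‿distribʳ-* _ x)) (cong -_ tx≡s)

    IsFrac-inverse : ∀ {s t x y} → IsFrac F a s t x → x ≢ 0# → x * y ≡ 1# → IsFrac F a t s y
    IsFrac-inverse {s} {t} {x} {y} (t≢0 , tx≡s) x≢0 xy≡1 =
      (λ s≡0 → *-≢0 t≢0 x≢0 (trans tx≡s s≡0)) , (begin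
        evalT F s a * y       ≡⟨ cong (_* y) tx≡s ⟨
        evalT F t a * x * y   ≡⟨ *-assoc _ x y ⟩
        evalT F t a * (x * y) ≡⟨ cong (evalT F t a *_) xy≡1 ⟩
        evalT F t a * 1#      ≡⟨ *-identityʳ _ ⟩
        evalT F t a           ∎)

    Gen⇒Frac : ∀ {x} → Gen F a x → Frac F a x
    Gen⇒Frac (gen i)            = var i , one , IsFrac-term (var i)
    Gen⇒Frac g𝟘                 = zer , one , IsFrac-term zer
    Gen⇒Frac g𝟙                 = one , one , IsFrac-term one
    Gen⇒Frac (g⊕ gx gy)         = _ , _ , IsFrac-+ (proj₂ (proj₂ (Gen⇒Frac gx))) (proj₂ (proj₂ (Gen⇒Frac gy)))
    Gen⇒Frac (g⊗ gx gy)         = _ , _ , IsFrac-* (proj₂ (proj₂ (Gen⇒Frac gx))) (proj₂ (proj₂ (Gen⇒Frac gy)))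
    Gen⇒Frac (g⊖ gx)            = _ , _ , IsFrac-neg (proj₂ (proj₂ (Gen⇒Frac gx)))
    Gen⇒Frac (ginv gx x≢0 xy≡1) = _ , _ , IsFrac-inverse (proj₂ (proj₂ (Gen⇒Frac gx))) x≢0 xy≡1

  -- Listing the leading coefficient separately lets nonzero polynomials be recognised by it.
  poly : ∀ {n} → Carrier F → Vec (Carrier F) n → Carrier F → Carrier F
  poly l []       x = l
  poly l (c ∷ cs) x = c + x * poly l cs x

  -- Synthetic division: `quot l r cs` is the quotient of `c ∷ cs` by x - r, whatever the constant
  -- term `c`. Its coefficients are the values at `r` of the tails of the polynomial, and its
  -- leading coefficient is still `l`.
  quot : ∀ {n} → Carrier F → Carrier F → Vec (Carrier F) n → Vec (Carrier F) n
  quot l r []       = []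
  quot l r (c ∷ cs) = poly l (c ∷ cs) r ∷ quot l r cs

  -- P(x) = (x − r) Q(x) + P(r), with the subtraction moved to the other side.
  poly-quot : ∀ {n} l r c (cs : Vec (Carrier F) n) x →
              poly l (c ∷ cs) x + r * poly l (quot l r cs) x ≡ x * poly l (quot l r cs) x + poly l (c ∷ cs) r
  poly-quot l r c []        x = solve 4 (λ c x l r → c :+ x :* l :+ r :* l := x :* l :+ (c :+ r :* l)) refl c x l r
  poly-quot l r c (c′ ∷ cs) x = begin
    c + x * P x + r * (P r + x * Q)
      ≡⟨ solve 6 (λ c x Px r Pr Q → c :+ x :* Px :+ r :* (Pr :+ x :* Q) := c :+ r :* Pr :+ x :* (Px :+ r :* Q)) refl
           c x (P x) r (P r) Q ⟩
    c + r * P r + x * (P x + r * Q)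
      ≡⟨ cong (λ z → c + r * P r + x * z) (poly-quot l r c′ cs x) ⟩
    c + r * P r + x * (x * Q + P r)
      ≡⟨ solve 5 (λ c x r Pr Q → c :+ r :* Pr :+ x :* (x :* Q :+ Pr) := x :* (Pr :+ x :* Q) :+ (c :+ r :* Pr)) refl
           c x r (P r) Q ⟩
    x * (P r + x * Q) + (c + r * P r) ∎
    where
    P = poly l (c′ ∷ cs)
    Q = poly l (quot l r cs) x

  module _ (φ : Hom F F) where
    open Hom φ

    poly-homo : ∀ {n} l (cs : Vec (Carrier F) n) x → ⟦ poly l cs x ⟧ ≡ poly ⟦ l ⟧ (Vec.map ⟦_⟧ cs) ⟦ x ⟧
    poly-homo l []       x = refl
    poly-homo l (c ∷ cs) x = trans (⊕-homo c _) (cong (⟦ c ⟧ +_)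
      (trans (⊗-homo x _) (cong (⟦ x ⟧ *_) (poly-homo l cs x))))

    quot-homo : ∀ {n} l r (cs : Vec (Carrier F) n) → Vec.map ⟦_⟧ (quot l r cs) ≡ quot ⟦ l ⟧ ⟦ r ⟧ (Vec.map ⟦_⟧ cs)
    quot-homo l r []       = refl
    quot-homo l r (c ∷ cs) = cong₂ _∷_ (poly-homo l (c ∷ cs) r) (quot-homo l r cs)

  module _ {B : Str} (B-isField : IsFieldStr B) (φ : Hom F B) where
    open Hom φ
    private module B = IsCommutativeRing (IsFieldStr.isCommutativeRing B-isField)

    homo-≢0 : ∀ {x} → x ≢ 0# → ⟦ x ⟧ ≢ 𝟘 B
    homo-≢0 {x} x≢0 φx≡0 with y , xy≡1 ← inverse x x≢0 = IsFieldStr.0≢1 B-isField (begin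
      𝟘 B                 ≡⟨ B.zeroˡ ⟦ y ⟧ ⟨
      _⊗_ B (𝟘 B) ⟦ y ⟧   ≡⟨ cong (λ z → _⊗_ B z ⟦ y ⟧) φx≡0 ⟨
      _⊗_ B ⟦ x ⟧ ⟦ y ⟧   ≡⟨ ⊗-homo x y ⟨
      ⟦ x * y ⟧           ≡⟨ cong ⟦_⟧ xy≡1 ⟩
      ⟦ 1# ⟧              ≡⟨ 𝟙-homo ⟩
      𝟙 B                 ∎)

    homo-injective : ∀ {x y} → ⟦ x ⟧ ≡ ⟦ y ⟧ → x ≡ y
    homo-injective {x} {y} φx≡φy = x∙y⁻¹≈ε⇒x≈y x y (decidable-stable em λ x-y≢0 → homo-≢0 x-y≢0 (begin
      ⟦ x + (- y) ⟧           ≡⟨ trans (⊕-homo x (- y)) (cong₂ (_⊕_ B) φx≡φy (⊖-homo y)) ⟩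
      _⊕_ B ⟦ y ⟧ (⊖_ B ⟦ y ⟧) ≡⟨ B.-‿inverseʳ ⟦ y ⟧ ⟩
      𝟘 B                     ∎))

  -- `T` and `Q` are chosen before `φ`, so one term describes the polynomial over `a` and its image
  -- over `b` at once. `root⇒image` uses the identity map to see that `T` is root-free over `a`, and
  -- the embedding to find a root of `T` over `b`.
  clear-denominators : ∀ {k} {a : Vec (Carrier F) k} → (∀ x → Frac F a x) → ∀ {n} l (cs : Vec (Carrier F) n) →
    ∃₂ λ (T : Term (suc k)) (Q : Term k) → evalT F Q a ≢ 0# ×
      (∀ (φ : Hom F F) {b} → (∀ i → Hom.⟦_⟧ φ (lookup a i) ≡ lookup b i) →
       ∀ x → evalT F T (x ∷ b) ≡ evalT F Q b * poly (Hom.⟦_⟧ φ l) (Vec.map (Hom.⟦_⟧ φ) cs) x)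
  clear-denominators frac l [] with s , t , (t≢0 , tl≡s) ← frac l =
    weaken s , t , t≢0 , λ φ {b} φa≡b x → let open Hom φ in
      begin
        evalT F (weaken s) (x ∷ b) ≡⟨ evalT-weaken F s x b ⟩
        evalT F s b                ≡⟨ evalT-homo φa≡b s ⟨
        ⟦ evalT F s _ ⟧            ≡⟨ cong ⟦_⟧ tl≡s ⟨
        ⟦ evalT F t _ * l ⟧        ≡⟨ ⊗-homo _ l ⟩
        ⟦ evalT F t _ ⟧ * ⟦ l ⟧    ≡⟨ cong (_* ⟦ l ⟧) (evalT-homo φa≡b t) ⟩
        evalT F t b * ⟦ l ⟧        ∎
  clear-denominators frac l (c ∷ cs)
    with s , t , (t≢0 , tc≡s) ← frac c | T , Q , Q≢0 , eq ← clear-denominators frac l cs =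
    -- With `c = s / t` and `T = Q P`, multiplying `c + x P` by `t Q` gives `s Q + x t T`.
    weaken (s ∙ Q) ∔ (var zero ∙ (weaken t ∙ T)) , t ∙ Q , *-≢0 t≢0 Q≢0 , λ φ {b} φa≡b x →
      let open Hom φ
          P  = poly ⟦ l ⟧ (Vec.map ⟦_⟧ cs) x
          s≡ = begin
            evalT F s b             ≡⟨ evalT-homo φa≡b s ⟨
            ⟦ evalT F s _ ⟧         ≡⟨ cong ⟦_⟧ tc≡s ⟨
            ⟦ evalT F t _ * c ⟧     ≡⟨ ⊗-homo _ c ⟩
            ⟦ evalT F t _ ⟧ * ⟦ c ⟧ ≡⟨ cong (_* ⟦ c ⟧) (evalT-homo φa≡b t) ⟩
            evalT F t b * ⟦ c ⟧     ∎
      in begin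
        evalT F (weaken (s ∙ Q)) (x ∷ b) + x * (evalT F (weaken t) (x ∷ b) * evalT F T (x ∷ b))
          ≡⟨ cong₂ _+_ (evalT-weaken F (s ∙ Q) x b)
               (cong (x *_) (cong₂ _*_ (evalT-weaken F t x b) (eq φ φa≡b x))) ⟩
        evalT F s b * evalT F Q b + x * (evalT F t b * (evalT F Q b * P))
          ≡⟨ cong (λ z → z * evalT F Q b + x * (evalT F t b * (evalT F Q b * P))) s≡ ⟩
        evalT F t b * ⟦ c ⟧ * evalT F Q b + x * (evalT F t b * (evalT F Q b * P))
          ≡⟨ solve 5 (λ t c Q x P → t :* c :* Q :+ x :* (t :* (Q :* P)) := t :* Q :* (c :+ x :* P)) refl
               (evalT F t b) ⟦ c ⟧ (evalT F Q b) x P ⟩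
        evalT F t b * evalT F Q b * (⟦ c ⟧ + x * P) ∎

  module _ {k} {a b : Vec (Carrier F) k} (frac : ∀ x → Frac F a x) (φ : Hom F F)
           (φa≡b : ∀ i → Hom.⟦_⟧ φ (lookup a i) ≡ lookup b i)
           (transfer : ∀ T → RootFree F a T → RootFree F b T) where
    open Hom φ

    -- By transfer, a polynomial whose image under φ has a root has a root r itself; dividing by x − r
    -- until y = φ r terminates because the degree drops.
    root⇒image : ∀ {n} l (cs : Vec (Carrier F) n) y → l ≢ 0# → poly ⟦ l ⟧ (Vec.map ⟦_⟧ cs) y ≡ 0# →
                 ∃ λ x → ⟦ x ⟧ ≡ y
    root⇒image l [] y l≢0 root = contradiction root (homo-≢0 isField φ l≢0)
    root⇒image l (c ∷ cs) y l≢0 root with em {∃ λ r → poly l (c ∷ cs) r ≡ 0#}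
    ... | no none with T , Q , Q≢0 , eq ← clear-denominators frac l (c ∷ cs) =
      contradiction T[y]≡0 (transfer T T-rootFree y)
      where
      T-rootFree : RootFree F a T
      T-rootFree x T[x]≡0 = none (x , zero-product Q≢0 (begin
        evalT F Q a * poly l (c ∷ cs) x                       ≡⟨ cong (λ ds → evalT F Q a * poly l (c ∷ ds) x) (map-id cs) ⟨
        evalT F Q a * poly l (c ∷ Vec.map (λ z → z) cs) x     ≡⟨ eq (id-hom F) (λ _ → refl) x ⟨
        evalT F T (x ∷ a)                                     ≡⟨ T[x]≡0 ⟩
        0#                                                    ∎))
      T[y]≡0 : evalT F T (y ∷ b) ≡ 0#
      T[y]≡0 = trans (eq φ φa≡b y) (trans (cong (evalT F Q b *_) root) (zeroʳ _))
    ... | yes (r , root′) with em {⟦ r ⟧ ≡ y}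
    ...   | yes φr≡y = r , φr≡y
    ...   | no  φr≢y = root⇒image l (quot l r cs) y l≢0
      (trans (cong (λ ds → poly ⟦ l ⟧ ds y) (quot-homo φ l r cs)) Q≡0)
      where
      Q = poly ⟦ l ⟧ (quot ⟦ l ⟧ ⟦ r ⟧ (Vec.map ⟦_⟧ cs)) y
      Q≡0 : Q ≡ 0#
      -- The image polynomial vanishes at `y` and at `⟦ r ⟧`, so the division identity reduces to
      -- `⟦ r ⟧ Q = y Q`; a nonzero `Q` would give `⟦ r ⟧ = y`.
      Q≡0 = decidable-stable em λ Q≢0 → φr≢y (*-cancelˡ-≢0 Q≢0 (begin
        Q * ⟦ r ⟧                                            ≡⟨ *-comm Q ⟦ r ⟧ ⟩
        ⟦ r ⟧ * Q                                            ≡⟨ +-identityˡ _ ⟨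
        0# + ⟦ r ⟧ * Q                                       ≡⟨ cong (_+ ⟦ r ⟧ * Q) root ⟨
        poly ⟦ l ⟧ (Vec.map ⟦_⟧ (c ∷ cs)) y + ⟦ r ⟧ * Q      ≡⟨ poly-quot ⟦ l ⟧ ⟦ r ⟧ ⟦ c ⟧ (Vec.map ⟦_⟧ cs) y ⟩
        y * Q + poly ⟦ l ⟧ (Vec.map ⟦_⟧ (c ∷ cs)) ⟦ r ⟧      ≡⟨ cong (y * Q +_) (poly-homo φ l (c ∷ cs) r) ⟨
        y * Q + ⟦ poly l (c ∷ cs) r ⟧                        ≡⟨ cong (y * Q +_) (trans (cong ⟦_⟧ root′) 𝟘-homo) ⟩
        y * Q + 0#                                           ≡⟨ +-identityʳ _ ⟩
        y * Q                                                ≡⟨ *-comm y Q ⟩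
        Q * y                                                ∎))

  -- Algebraic dependence

  -- The base-`d` digits of the index are the exponents, so `Fin (d ^ n)` enumerates all exponent
  -- vectors with entries below `d`.
  mon : ∀ d {n} → Vec (Carrier F) n → Fin (d ℕ.^ n) → Carrier F
  mon d         []       _ = 1#
  mon d {suc n} (y ∷ ys) j = y ^ toℕ (proj₁ (remQuot {d} (d ℕ.^ n) j)) * mon d ys (proj₂ (remQuot {d} (d ℕ.^ n) j))

  mon-combine : ∀ d {n} y (ys : Vec (Carrier F) n) (i : Fin d) e →
                mon d (y ∷ ys) (combine i e) ≡ y ^ toℕ i * mon d ys e
  mon-combine d {n} y ys i e =
    cong (λ ie → y ^ toℕ (proj₁ ie) * mon d ys (proj₂ ie)) (remQuot-combine {d} {d ℕ.^ n} i e)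

  -- The same monomials as a predicate, under which degrees add without index arithmetic. Exponents
  -- up to `D` inclusive correspond to `mon (suc D)`, as `Mono-index` records.
  Mono : ℕ → ∀ {n} → Vec (Carrier F) n → Carrier F → Set
  Mono D []       x = x ≡ 1#
  Mono D (y ∷ ys) x = ∃₂ λ i m → i ≤ D × Mono D ys m × x ≡ y ^ i * m

  Mono-mono : ∀ {D D′ n} → D ≤ D′ → (ys : Vec (Carrier F) n) → ∀ {x} → Mono D ys x → Mono D′ ys x
  Mono-mono D≤D′ []       x≡1 = x≡1
  Mono-mono D≤D′ (y ∷ ys) (i , m , i≤D , mm , eq) = i , m , ℕₚ.≤-trans i≤D D≤D′ , Mono-mono D≤D′ ys mm , eq

  Mono-1 : ∀ {D n} (ys : Vec (Carrier F) n) → Mono D ys 1#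
  Mono-1 []       = refl
  Mono-1 (y ∷ ys) = 0 , 1# , z≤n , Mono-1 ys , sym (*-identityˡ 1#)

  Mono-lookup : ∀ {n} (ys : Vec (Carrier F) n) i → Mono 1 ys (lookup ys i)
  Mono-lookup (y ∷ ys) zero    = 1 , 1# , s≤s z≤n , Mono-1 ys , sym (trans (*-identityʳ _) (*-identityʳ y))
  Mono-lookup (y ∷ ys) (suc i) = 0 , _ , z≤n , Mono-lookup ys i , sym (*-identityˡ _)

  Mono-* : ∀ {D D′ n} (ys : Vec (Carrier F) n) {x x′} → Mono D ys x → Mono D′ ys x′ → Mono (D ℕ.+ D′) ys (x * x′)
  Mono-* []       refl refl = *-identityˡ 1#
  Mono-* (y ∷ ys) (i , m , i≤D , mm , refl) (i′ , m′ , i′≤D′ , mm′ , refl) =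
    i ℕ.+ i′ , m * m′ , ℕₚ.+-mono-≤ i≤D i′≤D′ , Mono-* ys mm mm′ , (begin
      (y ^ i * m) * (y ^ i′ * m′)   ≡⟨ solve 4 (λ p m q m′ → (p :* m) :* (q :* m′) := (p :* q) :* (m :* m′)) refl
                                         (y ^ i) m (y ^ i′) m′ ⟩
      (y ^ i * y ^ i′) * (m * m′)   ≡⟨ cong (_* (m * m′)) (^-homo-* y i i′) ⟨
      y ^ (i ℕ.+ i′) * (m * m′)     ∎)

  Mono-index : ∀ {D n} (ys : Vec (Carrier F) n) {x} → Mono D ys x → ∃ λ j → mon (suc D) ys j ≡ x
  Mono-index     []       x≡1 = zero , sym x≡1
  Mono-index {D} (y ∷ ys) (i , m , i≤D , mm , refl) with e , mon≡m ← Mono-index ys mm =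
    combine (fromℕ< (s≤s i≤D)) e ,
    trans (mon-combine (suc D) y ys (fromℕ< (s≤s i≤D)) e)
          (cong₂ (λ p q → y ^ p * q) (toℕ-fromℕ< (s≤s i≤D)) mon≡m)

  -- Modules over a subring and degree bounds

  module _ {K : Carrier F → Set} (K-subring : IsSubring K) where
    open IsSubring K-subring

    -- The `K`-module generated by `B`. Being inductive, it needs no coordinates until `coordinates`
    -- extracts them for a finite family.
    data Span (B : Carrier F → Set) : Carrier F → Set where
      basis : ∀ {x} → B x → Span B x
      0ˢ    : Span B 0#
      _+ˢ_  : ∀ {x y} → Span B x → Span B y → Span B (x + y)
      _*ˢ_  : ∀ {c x} → K c → Span B x → Span B (c * x)

    Span-map : ∀ {B B′ : Carrier F → Set} → (∀ {x} → B x → B′ x) → ∀ {x} → Span B x → Span B′ x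
    Span-map f (basis b) = basis (f b)
    Span-map f 0ˢ        = 0ˢ
    Span-map f (p +ˢ q)  = Span-map f p +ˢ Span-map f q
    Span-map f (c *ˢ p)  = c *ˢ Span-map f p

    Span-* : ∀ {B B′ B″ : Carrier F → Set} → (∀ {x y} → B x → B′ y → B″ (x * y)) →
             ∀ {x y} → Span B x → Span B′ y → Span B″ (x * y)
    Span-* {B} {B′} {B″} f = go
      where
      basis-* : ∀ {x y} → B x → Span B′ y → Span B″ (x * y)
      basis-* b (basis b′)             = basis (f b b′)
      basis-* b 0ˢ                     = subst (Span B″) (sym (zeroʳ _)) 0ˢ
      basis-* b (p +ˢ q)               = subst (Span B″) (sym (distribˡ _ _ _)) (basis-* b p +ˢ basis-* b q)
      basis-* {x} b (_*ˢ_ {c} {y} Kc p) =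
        subst (Span B″) (solve 3 (λ c x y → c :* (x :* y) := x :* (c :* y)) refl c x y) (Kc *ˢ basis-* b p)

      go : ∀ {x y} → Span B x → Span B′ y → Span B″ (x * y)
      go (basis b) q = basis-* b q
      go 0ˢ        q = subst (Span B″) (sym (zeroˡ _)) 0ˢ
      go (p +ˢ p′) q = subst (Span B″) (sym (distribʳ _ _ _)) (go p q +ˢ go p′ q)
      go (Kc *ˢ p) q = subst (Span B″) (sym (*-assoc _ _ _)) (Kc *ˢ go p q)

    coordinates : ∀ {B : Carrier F → Set} {n} (u : Fin n → Carrier F) → (∀ {x} → B x → ∃ λ j → u j ≡ x) →
                  ∀ {x} → Span B x → ∃ λ (c : Fin n → Carrier F) → (∀ j → K (c j)) × x ≡ sum (λ j → c j * u j)
    coordinates u index (basis b) with j , refl ← index b = δ j , δ∈ j , sym (sum-δ j u)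
    coordinates u index 0ˢ = (λ _ → 0#) , (λ _ → 0∈) , sym (sum-zero λ j → zeroˡ (u j))
    coordinates u index (p +ˢ q)
      with c , c∈ , refl ← coordinates u index p | c′ , c′∈ , refl ← coordinates u index q =
      (λ j → c j + c′ j) , (λ j → +∈ (c∈ j) (c′∈ j)) , sym (trans
        (sum-cong-≗ λ j → distribʳ (u j) (c j) (c′ j)) (∑-distrib-+ (λ j → c j * u j) (λ j → c′ j * u j)))
    coordinates u index (_*ˢ_ {k} Kk p) with c , c∈ , refl ← coordinates u index p =
      (λ j → k * c j) , (λ j → *∈ Kk (c∈ j)) , trans (*-distribˡ-sum k (λ j → c j * u j))
        (sum-cong-≗ λ j → sym (*-assoc k (c j) (u j)))

    -- The coordinates of the `v j` form a matrix with more rows than columns; a vector of its left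
    -- kernel gives the relation.
    span-dependent : ∀ {B : Carrier F → Set} {m n} → n < m → (u : Fin n → Carrier F) →
      (∀ {x} → B x → ∃ λ j → u j ≡ x) → (v : Fin m → Carrier F) → (∀ j → Span B (v j)) →
      ∃ λ (l : Fin m → Carrier F) → (∀ j → K (l j)) × (∃ λ j → l j ≢ 0#) × sum (λ j → l j * v j) ≡ 0#
    span-dependent {m = m} {n} n<m u index v v∈ =
      l , l∈ , l≢0 , (begin
        sum (λ j → l j * v j)                        ≡⟨ sum-cong-≗ (λ j → cong (l j *_) (v≡ j)) ⟩
        sum (λ j → l j * sum (λ i → C j i * u i))    ≡⟨ sum-cong-≗ (λ j → *-distribˡ-sum (l j) (λ i → C j i * u i)) ⟩
        sum (λ j → sum (λ i → l j * (C j i * u i)))  ≡⟨ ∑-comm (λ j i → l j * (C j i * u i)) ⟩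
        sum (λ i → sum (λ j → l j * (C j i * u i)))  ≡⟨ sum-zero column ⟩
        0#                                           ∎)
      where
      C : Fin m → Fin n → Carrier F
      C j = proj₁ (coordinates u index (v∈ j))
      v≡ : ∀ j → v j ≡ sum (λ i → C j i * u i)
      v≡ j = proj₂ (proj₂ (coordinates u index (v∈ j)))
      ker = kernel n<m C (λ j → proj₁ (proj₂ (coordinates u index (v∈ j))))
      l = proj₁ ker
      l∈ = proj₁ (proj₂ ker)
      l≢0 = proj₁ (proj₂ (proj₂ ker))
      column : ∀ i → sum (λ j → l j * (C j i * u i)) ≡ 0#
      column i = begin
        sum (λ j → l j * (C j i * u i)) ≡⟨ sum-cong-≗ (λ j → *-assoc (l j) (C j i) (u i)) ⟨
        sum (λ j → l j * C j i * u i)   ≡⟨ *-distribʳ-sum (u i) (λ j → l j * C j i) ⟨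
        sum (λ j → l j * C j i) * u i   ≡⟨ cong (_* u i) (proj₂ (proj₂ (proj₂ ker)) i) ⟩
        0# * u i                        ≡⟨ zeroˡ (u i) ⟩
        0#                              ∎

    module _ {k} (a : Vec (Carrier F) k) where

      -- Polynomials in `a` over `K` in which each variable separately, rather than the total
      -- degree, is bounded by `D`.
      Deg≤ : ℕ → Carrier F → Set
      Deg≤ D = Span (Mono D a)

      Deg≤-mono : ∀ {D D′ x} → D ≤ D′ → Deg≤ D x → Deg≤ D′ x
      Deg≤-mono D≤D′ = Span-map (Mono-mono D≤D′ a)

      Deg≤-* : ∀ {D D′ x y} → Deg≤ D x → Deg≤ D′ y → Deg≤ (D ℕ.+ D′) (x * y)
      Deg≤-* = Span-* (Mono-* a)

      evalT-degree : ∀ t → ∃ λ D → Deg≤ D (evalT F t a)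
      evalT-degree (var i) = 1 , basis (Mono-lookup a i)
      evalT-degree (s ∔ t) with D , p ← evalT-degree s | D′ , q ← evalT-degree t =
        D ℕ.+ D′ , (Deg≤-mono (ℕₚ.m≤m+n D D′) p +ˢ Deg≤-mono (ℕₚ.m≤n+m D′ D) q)
      evalT-degree (s ∙ t) with D , p ← evalT-degree s | D′ , q ← evalT-degree t = D ℕ.+ D′ , Deg≤-* p q
      evalT-degree (neg t) with D , p ← evalT-degree t =
        D , subst (Deg≤ D) (-1*x≈-x _) (-∈ 1∈ *ˢ p)
      evalT-degree zer = 0 , 0ˢ
      evalT-degree one = 0 , basis (Mono-1 a)

      -- The product of the individual denominators. A single `q` and a single bound `D` serve all
      -- the `ys`, so that one power of `q` clears every monomial in them.
      common-denominator : (∀ x → Frac F a x) → ∀ {n} (ys : Vec (Carrier F) n) →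
        ∃₂ λ D q → q ≢ 0# × Deg≤ D q × (∀ i → Deg≤ D (q * lookup ys i))
      common-denominator frac [] = 0 , 1# , 1≢0 , basis (Mono-1 a) , λ ()
      common-denominator frac (y ∷ ys)
        with s , t , (t≢0 , ty≡s) ← frac y | D , q , q≢0 , q∈ , qys∈ ← common-denominator frac ys
        with Dₛ , s∈ ← evalT-degree s | Dₜ , t∈ ← evalT-degree t =
        Dₛ ℕ.+ Dₜ ℕ.+ D , evalT F t a * q , *-≢0 t≢0 q≢0 , Deg≤-* (Deg≤-mono (ℕₚ.m≤n+m Dₜ Dₛ) t∈) q∈ , λ where
          zero    → subst (Deg≤ _) (begin
              evalT F s a * q       ≡⟨ cong (_* q) ty≡s ⟨
              evalT F t a * y * q   ≡⟨ solve 3 (λ t y q → t :* y :* q := t :* q :* y) refl (evalT F t a) y q ⟩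
              evalT F t a * q * y   ∎)
            (Deg≤-* (Deg≤-mono (ℕₚ.m≤m+n Dₛ Dₜ) s∈) q∈)
          (suc i) → subst (Deg≤ _) (sym (*-assoc _ _ _)) (Deg≤-* (Deg≤-mono (ℕₚ.m≤n+m Dₜ Dₛ) t∈) (qys∈ i))

      -- The product consists of `i` factors `q * y` and `d − i` factors `q`, each of degree at most
      -- `D`.
      power-degree : ∀ {D q y} → Deg≤ D q → Deg≤ D (q * y) → ∀ {d i} → i ≤ d → Deg≤ (d ℕ.* D) (q ^ d * y ^ i)
      power-degree q∈ qy∈ {zero} z≤n = subst (Deg≤ 0) (sym (*-identityˡ 1#)) (basis (Mono-1 a))
      power-degree {q = q} {y} q∈ qy∈ {suc d} z≤n =
        subst (Deg≤ _) (sym (*-assoc q (q ^ d) 1#)) (Deg≤-* q∈ (power-degree {y = y} q∈ qy∈ {d} z≤n))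
      power-degree {q = q} {y} q∈ qy∈ {suc d} {suc i} (s≤s i≤d) =
        subst (Deg≤ _) (solve 4 (λ q y p r → (q :* y) :* (p :* r) := (q :* p) :* (y :* r)) refl q y (q ^ d) (y ^ i))
              (Deg≤-* qy∈ (power-degree q∈ qy∈ i≤d))

      mon-degree : ∀ {D q n} (ys : Vec (Carrier F) n) → Deg≤ D q → (∀ i → Deg≤ D (q * lookup ys i)) →
                   ∀ d j → Deg≤ (n ℕ.* (d ℕ.* D)) ((q ^ d) ^ n * mon d ys j)
      mon-degree [] q∈ qys∈ d j = subst (Deg≤ 0) (sym (*-identityˡ 1#)) (basis (Mono-1 a))
      mon-degree {q = q} {suc n} (y ∷ ys) q∈ qys∈ d j =
        subst (Deg≤ _)
          (solve 4 (λ p r z m → (p :* z) :* (r :* m) := (p :* r) :* (z :* m)) refl (q ^ d) ((q ^ d) ^ n) (y ^ toℕ i) _)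
          (Deg≤-* (power-degree q∈ (qys∈ zero) (ℕₚ.<⇒≤ (toℕ<n i))) (mon-degree ys q∈ (qys∈ ∘ suc) d e))
        where
        i = proj₁ (remQuot {d} (d ℕ.^ n) j)
        e = proj₂ (remQuot {d} (d ℕ.^ n) j)

      -- The dᵏ⁺¹ monomials in the ys, multiplied by a common denominator, lie in a K-module spanned by
      -- O(dᵏ) monomials in a.
      algebraically-dependent : (∀ x → Frac F a x) → (ys : Vec (Carrier F) (suc k)) →
        ∃₂ λ d (l : Fin (d ℕ.^ suc k) → Carrier F) →
          (∀ j → K (l j)) × (∃ λ j → l j ≢ 0#) × sum (λ j → l j * mon d ys j) ≡ 0#
      algebraically-dependent frac ys
        with D , q , q≢0 , q∈ , qys∈ ← common-denominator frac ys =
        d , l , l∈ , l≢0 , zero-product (^-≢0 (suc k) (^-≢0 d q≢0)) (begin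
          q′ * sum (λ j → l j * mon d ys j)     ≡⟨ *-distribˡ-sum q′ (λ j → l j * mon d ys j) ⟩
          sum (λ j → q′ * (l j * mon d ys j))   ≡⟨ sum-cong-≗ (λ j → solve 3 (λ q l m → q :* (l :* m) := l :* (q :* m))
                                                     refl q′ (l j) (mon d ys j)) ⟩
          sum (λ j → l j * (q′ * mon d ys j))   ≡⟨ proj₂ (proj₂ (proj₂ dep)) ⟩
          0#                                    ∎)
        where
        -- The value from `growth`: the `d ^ suc k` monomials in `ys` outnumber the `suc N ^ k`
        -- monomials in `a` that span their multiples by `q′`.
        d = suc (suc (suc k ℕ.* D) ℕ.^ k)
        q′ = (q ^ d) ^ suc k
        N = suc k ℕ.* (d ℕ.* D)
        dep = span-dependent (growth k D) (mon (suc N) a) (Mono-index a) (λ j → q′ * mon d ys j) (mon-degree ys q∈ qys∈ d)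
        l = proj₁ dep
        l∈ = proj₁ (proj₂ dep)
        l≢0 = proj₁ (proj₂ (proj₂ dep))

  -- Self-embeddings

  module _ (φ : Hom F F) where
    open Hom φ

    Fix : Carrier F → Set
    Fix x = ⟦ x ⟧ ≡ x

    Fix-subring : IsSubring Fix
    Fix-subring = record
      { 0∈ = 𝟘-homo
      ; 1∈ = 𝟙-homo
      ; +∈ = λ p q → trans (⊕-homo _ _) (cong₂ _+_ p q)
      ; *∈ = λ p q → trans (⊗-homo _ _) (cong₂ _*_ p q)
      ; -∈ = λ p → trans (⊖-homo _) (cong -_ p)
      }

    sum-homo : ∀ {n} (f : Fin n → Carrier F) → ⟦ sum f ⟧ ≡ sum (λ i → ⟦ f i ⟧)
    sum-homo {zero}  f = 𝟘-homo
    sum-homo {suc n} f = trans (⊕-homo _ _) (cong (⟦ f zero ⟧ +_) (sum-homo (f ∘ suc)))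

    ^-homo : ∀ x n → ⟦ x ^ n ⟧ ≡ ⟦ x ⟧ ^ n
    ^-homo x zero    = 𝟙-homo
    ^-homo x (suc n) = trans (⊗-homo _ _) (cong (⟦ x ⟧ *_) (^-homo x n))

    mon-homo : ∀ d {n} (ys : Vec (Carrier F) n) j → ⟦ mon d ys j ⟧ ≡ mon d (Vec.map ⟦_⟧ ys) j
    mon-homo d []       j = 𝟙-homo
    mon-homo d {suc n} (y ∷ ys) j =
      trans (⊗-homo _ _) (cong₂ _*_ (^-homo y (toℕ (proj₁ (remQuot {d} (d ℕ.^ n) j)))) (mon-homo d ys _))

    -- The coefficients are given by their preimages under `φ`, the form in which `root⇒image`
    -- consumes them.
    AlgebraicOverImage : Carrier F → Set
    AlgebraicOverImage y = ∃ λ n → ∃₂ λ l (cs : Vec (Carrier F) n) → l ≢ 0# × poly ⟦ l ⟧ (Vec.map ⟦_⟧ cs) y ≡ 0#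

    -- Strips vanishing top coefficients, turning a sum of powers into the form of `poly` with a
    -- nonzero leading coefficient unless nothing is left.
    leading-coefficient : ∀ {n} (f : Fin n → Carrier F) y →
      (∀ i → f i ≡ 0#) ⊎
      (∃ λ m → ∃₂ λ l (cs : Vec (Carrier F) m) →
         l ≢ 0# × sum (λ i → ⟦ f i ⟧ * y ^ toℕ i) ≡ poly ⟦ l ⟧ (Vec.map ⟦_⟧ cs) y)
    leading-coefficient {zero}  f y = inj₁ λ ()
    leading-coefficient {suc n} f y with leading-coefficient (f ∘ suc) y
    ... | inj₂ (m , l , cs , l≢0 , eq) = inj₂ (suc m , l , f zero ∷ cs , l≢0 , (begin
      ⟦ f zero ⟧ * 1# + sum (λ i → ⟦ f (suc i) ⟧ * (y * y ^ toℕ i))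
        ≡⟨ cong₂ _+_ (*-identityʳ _) (sum-cong-≗ λ i →
             solve 3 (λ c y p → c :* (y :* p) := y :* (c :* p)) refl ⟦ f (suc i) ⟧ y (y ^ toℕ i)) ⟩
      ⟦ f zero ⟧ + sum (λ i → y * (⟦ f (suc i) ⟧ * y ^ toℕ i))
        ≡⟨ cong (⟦ f zero ⟧ +_) (*-distribˡ-sum y (λ i → ⟦ f (suc i) ⟧ * y ^ toℕ i)) ⟨
      ⟦ f zero ⟧ + y * sum (λ i → ⟦ f (suc i) ⟧ * y ^ toℕ i)
        ≡⟨ cong (λ z → ⟦ f zero ⟧ + y * z) eq ⟩
      ⟦ f zero ⟧ + y * poly ⟦ l ⟧ (Vec.map ⟦_⟧ cs) y ∎))
    ... | inj₁ tail≡0 with em {f zero ≡ 0#}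
    ...   | yes head≡0 = inj₁ λ { zero → head≡0 ; (suc i) → tail≡0 i }
    ...   | no  head≢0 = inj₂ (0 , f zero , [] , head≢0 , (begin
      ⟦ f zero ⟧ * 1# + sum (λ i → ⟦ f (suc i) ⟧ * (y * y ^ toℕ i))
        ≡⟨ cong₂ _+_ (*-identityʳ _) (sum-zero λ i →
             trans (cong (_* (y * y ^ toℕ i)) (trans (cong ⟦_⟧ (tail≡0 i)) 𝟘-homo)) (zeroˡ _)) ⟩
      ⟦ f zero ⟧ + 0#
        ≡⟨ +-identityʳ _ ⟩
      ⟦ f zero ⟧ ∎))

    -- The tail is written as an image under `φ`; polynomials in it with fixed coefficients then lie
    -- in the image too.
    iterates : Carrier F → ∀ n → Vec (Carrier F) n
    iterates y zero    = []
    iterates y (suc n) = y ∷ Vec.map ⟦_⟧ (iterates y n)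

    -- Group the relation by powers of `y`. The coefficient of `y ^ i` is a polynomial in the later
    -- iterates with coefficients fixed by `φ`, hence equals `⟦ c i ⟧`, where `c i` is the same
    -- polynomial in `iterates y n`. Transcendence of `y` forces every `c i` to vanish, and each of
    -- these is a relation among fewer iterates.
    iterates-independent : ∀ y → ¬ AlgebraicOverImage y → ∀ d n (l : Fin (d ℕ.^ n) → Carrier F) → (∀ j → Fix (l j)) →
                           sum (λ j → l j * mon d (iterates y n) j) ≡ 0# → ∀ j → l j ≡ 0#
    iterates-independent y transcendental d zero l l∈ rel zero =
      trans (sym (trans (+-identityʳ _) (*-identityʳ _))) rel
    iterates-independent y transcendental d (suc n) l l∈ rel j =
      trans (cong l (sym (combine-remQuot {d} (d ℕ.^ n) j)))
            (l≡0 (proj₁ (remQuot {d} (d ℕ.^ n) j)) (proj₂ (remQuot {d} (d ℕ.^ n) j)))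
      where
      ys = iterates y n
      c : Fin d → Carrier F
      c i = sum (λ e → l (combine i e) * mon d ys e)
      φc≡ : ∀ i → ⟦ c i ⟧ ≡ sum (λ e → l (combine i e) * mon d (Vec.map ⟦_⟧ ys) e)
      φc≡ i = trans (sum-homo (λ e → l (combine i e) * mon d ys e))
        (sum-cong-≗ λ e → trans (⊗-homo _ _) (cong₂ _*_ (l∈ (combine i e)) (mon-homo d ys e)))
      rel′ : sum (λ i → ⟦ c i ⟧ * y ^ toℕ i) ≡ 0#
      rel′ = begin
        sum (λ i → ⟦ c i ⟧ * y ^ toℕ i)
          ≡⟨ sum-cong-≗ (λ i → trans (cong (_* y ^ toℕ i) (φc≡ i))
               (*-distribʳ-sum (y ^ toℕ i) (λ e → l (combine i e) * mon d (Vec.map ⟦_⟧ ys) e))) ⟩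
        sum (λ (i : Fin d) → sum (λ (e : Fin (d ℕ.^ n)) → l (combine i e) * mon d (Vec.map ⟦_⟧ ys) e * y ^ toℕ i))
          ≡⟨ sum-cong-≗ (λ i → sum-cong-≗ λ e → trans
               (solve 3 (λ l m p → l :* m :* p := l :* (p :* m)) refl (l (combine i e)) _ (y ^ toℕ i))
               (cong (l (combine i e) *_) (sym (mon-combine d y (Vec.map ⟦_⟧ ys) i e)))) ⟩
        sum (λ (i : Fin d) → sum (λ (e : Fin (d ℕ.^ n)) → l (combine i e) * mon d (iterates y (suc n)) (combine i e)))
          ≡⟨ sum-combine d (λ j → l j * mon d (iterates y (suc n)) j) ⟨
        sum (λ j → l j * mon d (iterates y (suc n)) j)
          ≡⟨ rel ⟩
        0# ∎
      c≡0 : ∀ i → c i ≡ 0#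
      c≡0 with leading-coefficient c y
      ... | inj₁ c≡0 = c≡0
      ... | inj₂ (m , lc , cs , lc≢0 , eq) = contradiction (m , lc , cs , lc≢0 , trans (sym eq) rel′) transcendental
      l≡0 : ∀ i e → l (combine i e) ≡ 0#
      l≡0 i = iterates-independent y transcendental d n (λ e → l (combine i e)) (λ e → l∈ (combine i e)) (c≡0 i)

    algebraic : ∀ {k} {a : Vec (Carrier F) k} → (∀ x → Frac F a x) → ∀ y → AlgebraicOverImage y
    algebraic {k} {a} frac y = decidable-stable em λ transcendental →
      let d , l , l∈ , (j , lⱼ≢0) , rel = algebraically-dependent Fix-subring a frac (iterates y (suc k))
      in lⱼ≢0 (iterates-independent y transcendental d (suc k) l l∈ rel j)

-- Embeddings from transfer of root-free terms

module Embedding (em : ExcludedMiddle 0ℓ) {A B : Str} (A-isField : IsFieldStr A) (B-isField : IsFieldStr B) where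

  private
    module A = Field em A A-isField
    module B = Field em B B-isField

  module _ {k} {a : Vec (Carrier A) k} {b : Vec (Carrier B) k} (frac : ∀ x → Frac A a x)
           (transfer : ∀ T → RootFree A a T → RootFree B b T) where

    -- A nonzero constant is a polynomial without roots.
    ≢0-transfer : ∀ t → evalT A t a ≢ 𝟘 A → evalT B t b ≢ 𝟘 B
    ≢0-transfer t t≢0 t≡0 = transfer (weaken t)
      (λ x wt≡0 → t≢0 (trans (sym (evalT-weaken A t x a)) wt≡0)) (𝟘 B) (trans (evalT-weaken B t (𝟘 B) b) t≡0)

    -- t vanishes exactly when the polynomial t x − 1 has no root.
    ≡0-transfer : ∀ t → evalT A t a ≡ 𝟘 A → evalT B t b ≡ 𝟘 B
    ≡0-transfer t t≡0 = decidable-stable em λ t≢0 →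
      let t⁻¹ , tt⁻¹≡1 = B.inverse _ t≢0
      in transfer ((weaken t ∙ var zero) ∔ neg one)
           (λ x root → A.0≢1 (begin
             𝟘 A                                ≡⟨ A.zeroˡ x ⟨
             𝟘 A A.* x                          ≡⟨ cong (A._* x) t≡0 ⟨
             evalT A t a A.* x                  ≡⟨ cong (A._* x) (evalT-weaken A t x a) ⟨
             evalT A (weaken t) (x ∷ a) A.* x   ≡⟨ A.x∙y⁻¹≈ε⇒x≈y _ _ root ⟩
             𝟙 A                                ∎))
           t⁻¹
           (begin
             evalT B (weaken t) (t⁻¹ ∷ b) B.* t⁻¹ B.+ (B.- 𝟙 B)
               ≡⟨ cong (λ z → z B.* t⁻¹ B.+ (B.- 𝟙 B)) (evalT-weaken B t t⁻¹ b) ⟩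
             evalT B t b B.* t⁻¹ B.+ (B.- 𝟙 B)
               ≡⟨ cong (B._+ (B.- 𝟙 B)) tt⁻¹≡1 ⟩
             𝟙 B B.+ (B.- 𝟙 B)
               ≡⟨ B.-‿inverseʳ (𝟙 B) ⟩
             𝟘 B ∎)
      where open ≡-Reasoning

    ≡-transfer : ∀ s t → evalT A s a ≡ evalT A t a → evalT B s b ≡ evalT B t b
    ≡-transfer s t s≡t = B.x∙y⁻¹≈ε⇒x≈y _ _ (≡0-transfer (s ∔ neg t)
      (trans (cong (A._+ (A.- evalT A t a)) s≡t) (A.-‿inverseʳ _)))

    image : ∀ x → ∃ λ y → ∃₂ λ s t → IsFrac A a s t x × IsFrac B b s t y
    image x with s , t , (t≢0 , tx≡s) ← frac x with y , q ← B.IsFrac-exists s t (≢0-transfer t t≢0) =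
      y , s , t , (t≢0 , tx≡s) , q

    embed : Carrier A → Carrier B
    embed x = proj₁ (image x)

    -- Independence of the fraction that `frac` supplies: two fractions for `x` satisfy a
    -- cross-multiplied equation between terms in `a`, which transfers to `b`. The homomorphism laws
    -- follow by computing with fractions on both sides.
    embed-IsFrac : ∀ {s t x} → IsFrac A a s t x → IsFrac B b s t (embed x)
    embed-IsFrac {s} {t} {x} (t≢0 , tx≡s) =
      let y , s₀ , t₀ , (_ , t₀x≡s₀) , (t₀≢0 , t₀y≡s₀) = image x in
      ≢0-transfer t t≢0 , B.*-cancelˡ-≢0 t₀≢0 (begin
        evalT B t₀ b B.* (evalT B t b B.* y) ≡⟨ B.*-swap (evalT B t₀ b) _ y ⟩
        evalT B t b B.* (evalT B t₀ b B.* y) ≡⟨ cong (evalT B t b B.*_) t₀y≡s₀ ⟩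
        evalT B t b B.* evalT B s₀ b         ≡⟨ ≡-transfer (t ∙ s₀) (t₀ ∙ s) (begin
            evalT A t a A.* evalT A s₀ a           ≡⟨ cong (evalT A t a A.*_) t₀x≡s₀ ⟨
            evalT A t a A.* (evalT A t₀ a A.* x)   ≡⟨ A.*-swap (evalT A t a) _ x ⟩
            evalT A t₀ a A.* (evalT A t a A.* x)   ≡⟨ cong (evalT A t₀ a A.*_) tx≡s ⟩
            evalT A t₀ a A.* evalT A s a           ∎) ⟩
        evalT B t₀ b B.* evalT B s b         ∎)
      where open ≡-Reasoning

    embed-evalT : ∀ t → embed (evalT A t a) ≡ evalT B t b
    embed-evalT t = B.IsFrac-unique (embed-IsFrac (A.IsFrac-term t)) (B.IsFrac-term t)

    embedding : Hom A B
    embedding = record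
      { ⟦_⟧    = embed
      ; ⊕-homo = λ x y → let _ , _ , p = frac x ; _ , _ , q = frac y in
          B.IsFrac-unique (embed-IsFrac (A.IsFrac-+ p q)) (B.IsFrac-+ (embed-IsFrac p) (embed-IsFrac q))
      ; ⊗-homo = λ x y → let _ , _ , p = frac x ; _ , _ , q = frac y in
          B.IsFrac-unique (embed-IsFrac (A.IsFrac-* p q)) (B.IsFrac-* (embed-IsFrac p) (embed-IsFrac q))
      ; ⊖-homo = λ x → let _ , _ , p = frac x in
          B.IsFrac-unique (embed-IsFrac (A.IsFrac-neg p)) (B.IsFrac-neg (embed-IsFrac p))
      ; 𝟘-homo = embed-evalT zer
      ; 𝟙-homo = embed-evalT one
      }

    embed-surjective : ∀ {y} → Frac B b y → ∃ λ x → embed x ≡ y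
    embed-surjective (s , t , (t≢0 , ty≡s)) with x , p ← A.IsFrac-exists s t (λ t≡0 → t≢0 (≡0-transfer t t≡0)) =
      x , B.IsFrac-unique (embed-IsFrac p) (t≢0 , ty≡s)

    isomorphism : (∀ y → Frac B b y) → A ≅ B
    isomorphism frac′ = record
      { to      = embed
      ; from    = λ y → proj₁ (embed-surjective (frac′ y))
      ; from-to = λ x → A.homo-injective B-isField embedding (proj₂ (embed-surjective (frac′ (embed x))))
      ; to-from = λ y → proj₂ (embed-surjective (frac′ y))
      ; pres-⊕  = ⊕-homo
      ; pres-⊗  = ⊗-homo
      ; pres-⊖  = ⊖-homo
      ; pres-𝟘  = 𝟘-homo
      ; pres-𝟙  = 𝟙-homo
      }
      where open Hom embedding

-- Tuples to which root-freeness transfers generate the field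

module _ (em : ExcludedMiddle 0ℓ) (F : Str) (isField : IsFieldStr F) where
  open Field em F isField
  open Embedding em isField isField

  transfer⇒generates : ∀ {k} {a b : Vec (Carrier F) k} → (∀ x → Frac F a x) →
                       (∀ T → RootFree F a T → RootFree F b T) → ∀ y → Frac F b y
  transfer⇒generates {a = a} {b} frac transfer y =
    let φ = embedding frac transfer
        n , l , cs , l≢0 , root = algebraic φ frac y
        x , φx≡y = root⇒image {b = b} frac φ (λ i → embed-evalT frac transfer (var i)) transfer l cs y l≢0 root
        s , t , p = frac x
    -- Since `y` is the image of `x`, a fraction for `x` in `a` becomes one for `y` in `b`.
    in s , t , subst (IsFrac F b s t) φx≡y (embed-IsFrac frac transfer p)

-- Enumeration of terms

-- Cantor's walk along the antidiagonals; from the end `(0 , q)` of one it jumps to the start of the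
-- next.
next : ℕ × ℕ → ℕ × ℕ
next (zero  , q) = suc q , zero
next (suc p , q) = p , suc q

unpair : ℕ → ℕ × ℕ
unpair zero    = 0 , 0
unpair (suc n) = next (unpair n)

unpair-surjective : ∀ p q → ∃ λ n → unpair n ≡ (p , q)
unpair-surjective p q = diagonal (p ℕ.+ q) q p refl
  where
  -- The walk is retraced backwards: along the antidiagonal while `q` is positive, then to the end
  -- of the previous one.
  diagonal : ∀ s q p → p ℕ.+ q ≡ s → ∃ λ n → unpair n ≡ (p , q)
  diagonal s (suc q) p eq with n , e ← diagonal s q (suc p) (trans (sym (ℕₚ.+-suc p q)) eq) = suc n , cong next e
  diagonal zero    zero zero    eq = 0 , refl
  diagonal (suc s) zero (suc p) eq
    with n , e ← diagonal s p zero (ℕₚ.suc-injective (trans (cong suc (sym (ℕₚ.+-identityʳ p))) eq)) = suc n , cong next e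

unpair₃ : ℕ → ℕ × ℕ × ℕ
unpair₃ n = proj₁ (unpair n) , unpair (proj₂ (unpair n))

unpair₃-surjective : ∀ i j l → ∃ λ n → unpair₃ n ≡ (i , j , l)
unpair₃-surjective i j l with r , er ← unpair-surjective j l with n , en ← unpair-surjective i r =
  n , cong₂ _,_ (cong proj₁ en) (trans (cong (unpair ∘ proj₂) en) er)

-- The first number is a constructor tag. All invalid codes yield `zer`, and so does every tag from
-- 5 on, which is how `zer` itself is coded.
node : ∀ {m} → (ℕ → Term m) → ℕ × ℕ → Term m
node {m} d (0 , r) with r ℕₚ.<? m
... | yes r<m = var (fromℕ< r<m)
... | no  _   = zer
node d (1 , r) = d (proj₁ (unpair r)) ∔ d (proj₂ (unpair r))
node d (2 , r) = d (proj₁ (unpair r)) ∙ d (proj₂ (unpair r))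
node d (3 , r) = neg (d r)
node d (4 , r) = one
node d (_ , r) = zer

-- The first argument is fuel bounding the depth of the term.
decode : ∀ {m} → ℕ → ℕ → Term m
decode zero    c = zer
decode (suc f) c = node (decode f) (unpair c)

decode-node : ∀ {m} f g {t : Term m} → node (decode f) g ≡ t → ∃ λ c → decode (suc f) c ≡ t
decode-node f (p , q) eq with c , e ← unpair-surjective p q = c , trans (cong (node (decode f)) e) eq

-- Asking for a code at every sufficiently large fuel lets the two subterms of a sum or product be
-- decoded with the same fuel.
decode-surjective : ∀ {m} (t : Term m) → ∃ λ f → ∀ g → f ≤ g → ∃ λ c → decode g c ≡ t
decode-surjective {m} (var i) = 1 , λ { (suc g) _ → decode-node g (0 , toℕ i) (node-var g) }
  where
  node-var : ∀ g → node (decode g) (0 , toℕ i) ≡ var i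
  node-var g with toℕ i ℕₚ.<? m
  ... | yes i<m = cong var (fromℕ<-toℕ i i<m)
  ... | no  i≮m = contradiction (toℕ<n i) i≮m
decode-surjective (s ∔ t) with f , ds ← decode-surjective s | f′ , dt ← decode-surjective t =
  suc (f ℕ.+ f′) , λ { (suc g) (s≤s f+f′≤g) →
    let c , ec = ds g (ℕₚ.m+n≤o⇒m≤o f f+f′≤g)
        d , ed = dt g (ℕₚ.m+n≤o⇒n≤o f f+f′≤g)
        r , er = unpair-surjective c d
    in decode-node g (1 , r) (cong₂ _∔_ (trans (cong (decode g ∘ proj₁) er) ec) (trans (cong (decode g ∘ proj₂) er) ed)) }
decode-surjective (s ∙ t) with f , ds ← decode-surjective s | f′ , dt ← decode-surjective t =
  suc (f ℕ.+ f′) , λ { (suc g) (s≤s f+f′≤g) →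
    let c , ec = ds g (ℕₚ.m+n≤o⇒m≤o f f+f′≤g)
        d , ed = dt g (ℕₚ.m+n≤o⇒n≤o f f+f′≤g)
        r , er = unpair-surjective c d
    in decode-node g (2 , r) (cong₂ _∙_ (trans (cong (decode g ∘ proj₁) er) ec) (trans (cong (decode g ∘ proj₂) er) ed)) }
decode-surjective (neg t) with f , dt ← decode-surjective t =
  suc f , λ { (suc g) (s≤s f≤g) → let c , ec = dt g f≤g in decode-node g (3 , c) (cong neg ec) }
decode-surjective zer = 1 , λ { (suc g) _ → decode-node g (5 , 0) refl }
decode-surjective one = 1 , λ { (suc g) _ → decode-node g (4 , 0) refl }

term : ∀ {m} → ℕ → Term m
term n = decode (proj₁ (unpair n)) (proj₂ (unpair n))

term-surjective : ∀ {m} (t : Term m) → ∃ λ n → term n ≡ t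
term-surjective t with f , dt ← decode-surjective t with c , ec ← dt f ℕₚ.≤-refl with n , en ← unpair-surjective f c =
  n , trans (cong (λ fc → decode (proj₁ fc) (proj₂ fc)) en) ec

-- Invariance of satisfaction under isomorphism

module _ {A B : Str} (i : A ≅ B) where
  open _≅_ i

  to-hom : Hom A B
  to-hom = record
    { ⟦_⟧ = to ; ⊕-homo = pres-⊕ ; ⊗-homo = pres-⊗ ; ⊖-homo = pres-⊖ ; 𝟘-homo = pres-𝟘 ; 𝟙-homo = pres-𝟙 }

  to-evalT : ∀ {m} (t : Term m) ρ → to (evalT A t ρ) ≡ evalT B t (Vec.map to ρ)
  to-evalT t ρ = Hom.evalT-homo to-hom (λ j → sym (lookup-map j to ρ)) t

  to-injective : ∀ {x y} → to x ≡ to y → x ≡ y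
  to-injective eq = trans (sym (from-to _)) (trans (cong from eq) (from-to _))

  -- Negation makes an equivalence necessary here; above the quantifier-free level one direction is
  -- enough, as universally quantified tuples are pulled back along `from`.
  satQF-≅ : ∀ {m} (φ : QF m) ρ → satQF A φ ρ ⇔ satQF B φ (Vec.map to ρ)
  satQF-≅ (s ≐ t) ρ = mk⇔
    (λ eq → trans (sym (to-evalT s ρ)) (trans (cong to eq) (to-evalT t ρ)))
    (λ eq → to-injective (trans (to-evalT s ρ) (trans eq (sym (to-evalT t ρ)))))
  satQF-≅ tt       ρ = mk⇔ (λ p → p) (λ p → p)
  satQF-≅ ff       ρ = mk⇔ (λ p → p) (λ p → p)
  satQF-≅ (¬' φ)   ρ = ¬-cong-⇔ (satQF-≅ φ ρ)
  satQF-≅ (φ ∧' ψ) ρ = satQF-≅ φ ρ ×-⇔ satQF-≅ ψ ρ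
  satQF-≅ (φ ∨' ψ) ρ = satQF-≅ φ ρ ⊎-⇔ satQF-≅ ψ ρ

  map-to-from : ∀ {n} (xs : Vec (Carrier B) n) → Vec.map to (Vec.map from xs) ≡ xs
  map-to-from xs = trans (sym (map-∘ to from xs)) (trans (map-cong to-from xs) (map-id xs))

  mutual
    satΣ-≅ : ∀ {α m} (φ : Σf α m) ρ → satΣ A φ ρ → satΣ B φ (Vec.map to ρ)
    satΣ-≅ (qfΣ φ)        ρ p            = Equivalence.to (satQF-≅ φ ρ) p
    satΣ-≅ (⋁∃ k lvl _ φ) ρ (j , xs , p) =
      j , Vec.map to xs , subst (satΠ B (φ j)) (map-++ to xs ρ) (satΠ-≅ (φ j) (xs Vec.++ ρ) p)

    satΠ-≅ : ∀ {α m} (φ : Πf α m) ρ → satΠ A φ ρ → satΠ B φ (Vec.map to ρ)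
    satΠ-≅ (qfΠ φ)        ρ p      = Equivalence.to (satQF-≅ φ ρ) p
    satΠ-≅ (⋀∀ k lvl _ φ) ρ p j xs =
      subst (satΣ B (φ j))
        (trans (map-++ to (Vec.map from xs) ρ) (cong (Vec._++ Vec.map to ρ) (map-to-from xs)))
        (satΣ-≅ (φ j) (Vec.map from xs Vec.++ ρ) (p j (Vec.map from xs)))

-- The Scott sentence

-- Variables 1, 2, 3 are universally quantified, variable 0 is the existentially quantified inverse of variable 1.
fieldAxioms : QF 4
fieldAxioms =
  ((((x ∔ y) ∔ z) ≐ (x ∔ (y ∔ z))) ∧' (((x ∔ y) ≐ (y ∔ x)) ∧' ((zer ∔ x) ≐ x))) ∧'
  ((((neg x ∔ x) ≐ zer) ∧' (((x ∙ y) ∙ z) ≐ (x ∙ (y ∙ z)))) ∧'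
  ((((x ∙ y) ≐ (y ∙ x)) ∧' ((one ∙ x) ≐ x)) ∧'
  (((x ∙ (y ∔ z)) ≐ ((x ∙ y) ∔ (x ∙ z))) ∧'
  ((¬' (zer ≐ one)) ∧' ((x ≐ zer) ∨' ((x ∙ w) ≐ one))))))
  where
  w = var zero
  x = var (suc zero)
  y = var (suc (suc zero))
  z = var (suc (suc (suc zero)))

fieldAxioms-sound : ∀ B → (∀ x y z → ∃ λ w → satQF B fieldAxioms (w ∷ x ∷ y ∷ z ∷ [])) → IsFieldStr B
fieldAxioms-sound B ax = record
  { isCommutativeRing = record
    { isRing = record
      { +-isAbelianGroup = record
        { isGroup = record
          { isMonoid = record
            { isSemigroup = record
              { isMagma = isMagma (_⊕_ B)
              ; assoc = λ x y z → proj₁ (proj₁ (proj₂ (ax x y z))) }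
            ; identity = comm∧idˡ⇒id +-comm (λ x → proj₂ (proj₂ (proj₁ (proj₂ (ax x x x))))) }
          ; inverse = comm∧invˡ⇒inv +-comm (λ x → proj₁ (proj₁ (proj₂ (proj₂ (ax x x x)))))
          ; ⁻¹-cong = cong (⊖_ B) }
        ; comm = +-comm }
      ; *-cong = cong₂ (_⊗_ B)
      ; *-assoc = λ x y z → proj₂ (proj₁ (proj₂ (proj₂ (ax x y z))))
      ; *-identity = comm∧idˡ⇒id *-comm (λ x → proj₂ (proj₁ (proj₂ (proj₂ (proj₂ (ax x x x))))))
      ; distrib = comm∧distrˡ⇒distr (cong₂ (_⊕_ B)) *-comm
                    (λ x y z → proj₁ (proj₂ (proj₂ (proj₂ (proj₂ (ax x y z)))))) }
    ; *-comm = *-comm }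
  ; 0≢1 = proj₁ (proj₂ (proj₂ (proj₂ (proj₂ (proj₂ (ax (𝟘 B) (𝟘 B) (𝟘 B)))))))
  ; inverse = inverse
  }
  where
  open import Algebra.Consequences.Setoid (setoid (Carrier B)) using (comm∧idˡ⇒id; comm∧invˡ⇒inv; comm∧distrˡ⇒distr)
  +-comm : ∀ x y → _⊕_ B x y ≡ _⊕_ B y x
  +-comm x y = proj₁ (proj₂ (proj₁ (proj₂ (ax x y y))))
  *-comm : ∀ x y → _⊗_ B x y ≡ _⊗_ B y x
  *-comm x y = proj₁ (proj₁ (proj₂ (proj₂ (proj₂ (ax x y y)))))
  inverse : ∀ x → x ≢ 𝟘 B → ∃ λ y → _⊗_ B x y ≡ 𝟙 B
  inverse x x≢0 with w , _ , _ , _ , _ , _ , p ← ax x x x = w , [ (λ x≡0 → contradiction x≡0 x≢0) , (λ e → e) ] p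

fieldAxioms-complete : ExcludedMiddle 0ℓ → ∀ F → IsFieldStr F →
                       ∀ x y z → ∃ λ w → satQF F fieldAxioms (w ∷ x ∷ y ∷ z ∷ [])
fieldAxioms-complete em F isField x y z =
  w , (+-assoc x y z , +-comm x y , +-identityˡ x) , (-‿inverseˡ x , *-assoc x y z) ,
  (*-comm x y , *-identityˡ x) , distribˡ x y z , 0≢1 , x≡0∨xw≡1
  where
  open IsFieldStr isField
  open IsCommutativeRing isCommutativeRing
  invert : ∃ λ w → x ≡ 𝟘 F ⊎ _⊗_ F x w ≡ 𝟙 F
  invert with em {x ≡ 𝟘 F}
  -- Any witness would do for zero.
  ... | yes x≡0 = x , inj₁ x≡0
  ... | no  x≢0 = let w , xw≡1 = inverse x x≢0 in w , inj₂ xw≡1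
  w = proj₁ invert
  x≡0∨xw≡1 = proj₂ invert

module ScottSentence (em : ExcludedMiddle 0ℓ) (F : Str) {k} (a : Vec (Carrier F) k) where

  -- Conjunctions range over all of ℕ, so terms that have a root over `a` contribute the trivial
  -- conjunct `tt`; dually, `bad-root` contributes `ff` to a disjunction. Taking the decision as an
  -- argument allows proofs to split on it.
  no-root : ∀ {m} {T : Term (suc k)} → Dec (RootFree F a T) → Term m → QF m
  no-root (yes _) t = ¬' (t ≐ zer)
  no-root (no  _) t = tt

  bad-root : ∀ {m} {T : Term (suc k)} → Dec (RootFree F a T) → Term m → QF m
  bad-root (yes _) t = t ≐ zer
  bad-root (no  _) t = ff

  -- The tuples of variables end in the empty tuple of parameters, whence the k + 0.
  skip₀ : Fin (suc k) → Fin (suc (k ℕ.+ 0))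
  skip₀ zero    = zero
  skip₀ (suc i) = suc (i ↑ˡ 0)

  skip₁ : Fin (suc k) → Fin (suc (suc (k ℕ.+ 0)))
  skip₁ zero    = zero
  skip₁ (suc i) = suc (suc (i ↑ˡ 0))

  skip₂ : Fin k → Fin (suc (suc (k ℕ.+ 0)))
  skip₂ i = suc (suc (i ↑ˡ 0))

  rootFreeAxiom : ℕ → QF (suc (k ℕ.+ 0))
  rootFreeAxiom i = no-root {T = term i} em (rename skip₀ (term i))

  -- Variable 0 is a candidate root `x`, variable 1 the element `y` to be generated, and the rest is
  -- the tuple. The implication from the type of the tuple to generation becomes a disjunction:
  -- failure of the type is witnessed by a root, hence existential, which keeps the axiom at level
  -- Σ⁰₁.
  generationAxiom : ℕ × ℕ × ℕ → QF (suc (suc (k ℕ.+ 0)))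
  generationAxiom (i , j , l) =
    bad-root {T = term i} em (rename skip₁ (term i)) ∨'
    ((¬' (rename skip₂ (term l) ≐ zer)) ∧' ((rename skip₂ (term l) ∙ var (suc zero)) ≐ rename skip₂ (term j)))

  block : ℕ → ℕ
  block zero    = 3
  block (suc _) = suc k

  -- There are only two distinct conjuncts, the field axioms at index 0 and generation, repeated at
  -- all later indices.
  axiom : ∀ i → Σf 1 (block i ℕ.+ 0)
  axiom zero    = ⋁∃ (λ _ → 1) (λ _ → 0) (λ _ → s≤s z≤n) (λ _ → qfΠ fieldAxioms)
  axiom (suc _) = ⋁∃ (λ _ → 1) (λ _ → 0) (λ _ → s≤s z≤n) λ n →
    qfΠ (generationAxiom (unpair₃ n))

  sentence : dΣ 2
  sentence =
    -- A single existential statement about the tuple, repeated at every index.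
    ⋁∃ (λ _ → k) (λ _ → 1) (λ _ → s≤s (s≤s z≤n))
       (λ _ → ⋀∀ (λ _ → 1) (λ _ → 0) (λ _ → s≤s z≤n) (λ i → qfΣ (rootFreeAxiom i))) ,
    ⋀∀ block (λ _ → 1) (λ _ → s≤s (s≤s z≤n)) axiom

  -- Meaning of the axioms in a structure

  module _ (B : Str) where

    evalT-skip₀ : ∀ t x (b : Vec (Carrier B) k) → evalT B (rename skip₀ t) (x ∷ b Vec.++ []) ≡ evalT B t (x ∷ b)
    evalT-skip₀ t x b = evalT-rename B skip₀ (λ { zero → refl ; (suc i) → lookup-++ˡ b [] i }) t

    evalT-skip₁ : ∀ t x y (b : Vec (Carrier B) k) → evalT B (rename skip₁ t) (x ∷ y ∷ b Vec.++ []) ≡ evalT B t (x ∷ b)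
    evalT-skip₁ t x y b = evalT-rename B skip₁ (λ { zero → refl ; (suc i) → lookup-++ˡ b [] i }) t

    evalT-skip₂ : ∀ t x y (b : Vec (Carrier B) k) → evalT B (rename skip₂ t) (x ∷ y ∷ b Vec.++ []) ≡ evalT B t b
    evalT-skip₂ t x y b = evalT-rename B skip₂ (λ i → lookup-++ˡ b [] i) t

    rootFreeAxioms⇒transfer : ∀ {b} → (∀ i x → satQF B (rootFreeAxiom i) (x ∷ b Vec.++ [])) →
                              ∀ T → RootFree F a T → RootFree B b T
    rootFreeAxioms⇒transfer {b} sat T rf x root with i , refl ← term-surjective T = go em (sat i x)
      where
      go : (d : Dec (RootFree F a T)) → ¬ satQF B (no-root d (rename skip₀ T)) (x ∷ b Vec.++ [])
      go (yes _)   ne = ne (trans (evalT-skip₀ T x b) root)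
      go (no  ¬rf) _  = ¬rf rf

    transfer⇒rootFreeAxioms : ∀ {b} → (∀ T → RootFree F a T → RootFree B b T) →
                              ∀ i x → satQF B (rootFreeAxiom i) (x ∷ b Vec.++ [])
    transfer⇒rootFreeAxioms {b} transfer i x = go em
      where
      go : (d : Dec (RootFree F a (term i))) → satQF B (no-root d (rename skip₀ (term i))) (x ∷ b Vec.++ [])
      go (yes rf) root = transfer (term i) rf x (trans (sym (evalT-skip₀ (term i) x b)) root)
      go (no  _)       = tt

    module _ (B-isField : IsFieldStr B) where
      open Field em B B-isField

      generationAxiom⇒Frac : ∀ {b} → (∀ T → RootFree F a T → RootFree B b T) →
        ∀ ijl x y → satQF B (generationAxiom ijl) (x ∷ y ∷ b Vec.++ []) → Frac B b y
      generationAxiom⇒Frac {b} transfer (i , j , l) x y (inj₁ bad) = ⊥-elim (go em bad)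
        where
        go : (d : Dec (RootFree F a (term i))) → ¬ satQF B (bad-root d (rename skip₁ (term i))) (x ∷ y ∷ b Vec.++ [])
        go (no _) ()
        go (yes rf) root = transfer (term i) rf x (trans (sym (evalT-skip₁ (term i) x y b)) root)
      generationAxiom⇒Frac {b} transfer (i , j , l) x y (inj₂ (t≢0 , ty≡s)) = term j , term l ,
        ( (λ t≡0 → t≢0 (trans (evalT-skip₂ (term l) x y b) t≡0))
        , trans (cong (_* y) (sym (evalT-skip₂ (term l) x y b))) (trans ty≡s (evalT-skip₂ (term j) x y b)) )

      Frac⇒generationAxiom : ∀ {b y} → Frac B b y → ∃₂ λ j l → ∀ i x → satQF B (generationAxiom (i , j , l)) (x ∷ y ∷ b Vec.++ [])
      Frac⇒generationAxiom {b} {y} (s , t , (t≢0 , ty≡s))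
        with j , refl ← term-surjective s | l , refl ← term-surjective t = j , l , λ i x → inj₂
        ( (λ t≡0 → t≢0 (trans (sym (evalT-skip₂ t x y b)) t≡0))
        , trans (cong (_* y) (evalT-skip₂ t x y b)) (trans ty≡s (sym (evalT-skip₂ s x y b))) )

    bad-root⇒generationAxiom : ∀ {b T x} → RootFree F a T → evalT B T (x ∷ b) ≡ 𝟘 B →
      ∃ λ i → ∀ j l y → satQF B (generationAxiom (i , j , l)) (x ∷ y ∷ b Vec.++ [])
    bad-root⇒generationAxiom {b} {T} {x} rf root with i , refl ← term-surjective T = i , λ j l y → inj₁ (go em y)
      where
      go : (d : Dec (RootFree F a T)) → ∀ y → satQF B (bad-root d (rename skip₁ T)) (x ∷ y ∷ b Vec.++ [])
      go (yes _)   y = trans (evalT-skip₁ T x y b) root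
      go (no  ¬rf) y = contradiction rf ¬rf

    model⇒≅ : IsFieldStr F → (∀ x → Gen F a x) → B ⊨d sentence → F ≅ B
    model⇒≅ F-isField generates ((_ , b , type) , axioms) =
      isomorphism (λ x → Field.Gen⇒Frac em F F-isField (generates x)) transfer λ y →
        -- Conjunct 1 is the generation statement, applied to the tuple `b` realising the type.
        let n , x∷[] , sat = axioms 1 (y ∷ b) in frac y n x∷[] sat
      where
      B-isField : IsFieldStr B
      B-isField = fieldAxioms-sound B λ x y z → inverse (axioms 0 (x ∷ y ∷ z ∷ []))
        where
        inverse : ∀ {ρ : Vec (Carrier B) 3} → satΣ B (axiom 0) ρ → ∃ λ w → satQF B fieldAxioms (w ∷ ρ)
        inverse (_ , w ∷ [] , sat) = w , sat
      transfer : ∀ T → RootFree F a T → RootFree B b T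
      transfer = rootFreeAxioms⇒transfer λ i x → type i (x ∷ [])
      open Field em B B-isField
      open Embedding em F-isField B-isField
      frac : ∀ y n xs → satΠ B (qfΠ (generationAxiom (unpair₃ n))) (xs Vec.++ (y ∷ b Vec.++ [])) → Frac B b y
      frac y n (x ∷ []) sat = generationAxiom⇒Frac B-isField transfer (unpair₃ n) x y sat

  satisfied : IsFieldStr F → (∀ x → Gen F a x) → F ⊨d sentence
  satisfied isField generates =
    (0 , a , λ { i (x ∷ []) → transfer⇒rootFreeAxioms F (λ T rf → rf) i x }) , axioms
    where
    open Field em F isField
    generation : ∀ b y → satΣ F (axiom 1) (y ∷ b Vec.++ [])
    generation b y with em {∃₂ λ T x → RootFree F a T × evalT F T (x ∷ b) ≡ 𝟘 F}
    ... | yes (T , x , rf , root) =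
      let i , sat = bad-root⇒generationAxiom F {b = b} {T} {x} rf root
          n , e   = unpair₃-surjective i 0 0
      in n , x ∷ [] , subst (λ ijl → satQF F (generationAxiom ijl) (x ∷ y ∷ b Vec.++ [])) (sym e) (sat 0 0 y)
    ... | no none =
      let j , l , sat = Frac⇒generationAxiom F isField {b = b} {y} (transfer⇒generates em F isField {b = b}
                          (Gen⇒Frac ∘ generates) (λ T rf x root → none (T , x , rf , root)) y)
          n , e       = unpair₃-surjective 0 j l
      in n , 0# ∷ [] , subst (λ ijl → satQF F (generationAxiom ijl) (0# ∷ y ∷ b Vec.++ [])) (sym e) (sat 0 0#)
    axioms : satΠ F (proj₂ sentence) []
    axioms zero    (x ∷ y ∷ z ∷ []) =
      let w , sat = fieldAxioms-complete em F isField x y z in 0 , w ∷ [] , sat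
    axioms (suc _) (y ∷ b) = generation b y

theorem1p6 : ExcludedMiddle 0ℓ → ∀ (F : Str) → IsFieldStr F → FinitelyGenerated F →
    Σ (dΣ 2) λ θ → IsScottSentence θ F
theorem1p6 em F isField (k , a , generates) = sentence , λ B _ →
  model⇒≅ B isField generates ,
  λ i → let Σ₂ , Π₂ = satisfied isField generates in satΣ-≅ i (proj₁ sentence) [] Σ₂ , satΠ-≅ i (proj₂ sentence) [] Π₂
  where open ScottSentence em F a
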